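{- The operator $\mathrm{d}=q\frac{d}{dq}$ maps $\mathcal{MD}$ into itself (hence is a derivation of the $\mathbb{Q}$-algebra $\mathcal{MD}$), and for all $k,l\ge 0$ it maps $\mathrm{Fil}^{W,L}_{k,l}(\mathcal{MD})$ into $\mathrm{Fil}^{W,L}_{k+2,l+1}(\mathcal{MD})$.
   Context: For integers $r_1,\dots,r_l\ge 0$ and $n\ge 1$ let $\sigma_{r_1,\dots,r_l}(n)=\sum v_1^{r_1}\cdots v_l^{r_l}$, summed over all positive integers $u_1>\dots>u_l>0$, $v_1,\dots,v_l>0$ with $u_1v_1+\dots+u_lv_l=n$. For integers $s_1,\dots,s_l\ge1$ the bracket is $[s_1,\dots,s_l]=\frac{1}{(s_1-1)!\cdots(s_l-1)!}\sum_{n>0}\sigma_{s_1-1,\dots,s_l-1}(n)q^n\in\mathbb{Q}[[q]]$, of weight $s_1+\dots+s_l$ and length $l$; $[\emptyset]=1$ has weight and length $0$. $\mathcal{MD}$ is the $\mathbb{Q}$-span of $1$ and all brackets; it is a $\mathbb{Q}$-algebra under multiplication of power series. $\mathrm{Fil}^{W,L}_{k,l}(\mathcal{MD})$ is the $\mathbb{Q}$-span of all brackets (including $1$) of weight $\le k$ and length $\le l$. -}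

module Defs where

open import Data.Nat as ℕ using (ℕ; zero; suc; _≤_; _∸_; _^_; _!; NonZero; _≤ᵇ_)
open import Data.Nat.Properties using (_!≢0; m*n≢0)
open import Data.Integer using (+_)
open import Data.Rational as ℚ using (ℚ; 0ℚ)
open import Data.List using (List; []; _∷_; length)
open import Data.Nat.ListAction using (sum)
open import Data.List.Relation.Unary.All using (All)
open import Data.Product using (Σ; _×_; _,_; proj₁; proj₂)
open import Data.Bool using (if_then_else_)
open import Relation.Binary.PropositionalEquality using (_≡_)

sumFrom1 : ℕ → (ℕ → ℕ) → ℕ
sumFrom1 zero    f = 0
sumFrom1 (suc b) f = sumFrom1 b f ℕ.+ f (suc b)

-- sig rs n b = Σ v_1^{r_1}⋯v_l^{r_l} over b ≥ u_1 > … > u_l > 0, v_i > 0,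
-- with u_1 v_1 + … + u_l v_l = n.
sig : List ℕ → ℕ → ℕ → ℕ
sig []       zero    b = 1
sig []       (suc n) b = 0
sig (r ∷ rs) n       b =
  sumFrom1 b (λ u → sumFrom1 n (λ v →
    if (u ℕ.* v) ≤ᵇ n then v ^ r ℕ.* sig rs (n ∸ u ℕ.* v) (u ∸ 1) else 0))

-- σ_{r_1,…,r_l}(n)  (u_1 ≤ n is automatic since v_1 ≥ 1)
σ : List ℕ → ℕ → ℕ
σ rs n = sig rs n n

Series : Set
Series = ℕ → ℚ

factProd : List ℕ → ℕ
factProd []      = 1
factProd (s ∷ ss) = ((s ∸ 1) !) ℕ.* factProd ss

factProd≢0 : ∀ ss → NonZero (factProd ss)
factProd≢0 []       = _
factProd≢0 (s ∷ ss) = m*n≢0 _ _ {{(s ∸ 1) !≢0}} {{factProd≢0 ss}}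

minus1 : List ℕ → List ℕ
minus1 []       = []
minus1 (s ∷ ss) = (s ∸ 1) ∷ minus1 ss

-- coefficient sequence of the bracket [s_1,…,s_l].
-- For l ≥ 1 the n = 0 coefficient is σ(0) = 0, and for s = [] this gives the
-- series 1, matching [∅] = 1.
bracket : List ℕ → Series
bracket ss n = (+ σ (minus1 ss) n ℚ./ factProd ss) {{factProd≢0 ss}}

weight : List ℕ → ℕ
weight ss = sum ss

Admissible : List ℕ → Set
Admissible ss = All (1 ≤_) ss

LinComb : Set
LinComb = List (ℚ × List ℕ)

evalLC : LinComb → Series
evalLC []             n = 0ℚ
evalLC ((c , s) ∷ cs) n = c ℚ.* bracket s n ℚ.+ evalLC cs n

InMD : Series → Set
InMD f = Σ LinComb λ L →
  All (λ p → Admissible (proj₂ p)) L × (∀ n → f n ≡ evalLC L n)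

InFil : ℕ → ℕ → Series → Set
InFil k l f = Σ LinComb λ L →
  All (λ p → Admissible (proj₂ p) × weight (proj₂ p) ≤ k × length (proj₂ p) ≤ l) L
  × (∀ n → f n ≡ evalLC L n)

-- d = q d/dq : Σ a_n q^n ↦ Σ n a_n q^n
dq : Series → Series
dq f n = (+ n ℚ./ 1) ℚ.* f n

{-# OPTIONS --safe #-}

-- Let W be a weight on the v-coordinates and let S(W) be the sum of q^(Σ u_i v_i) W(v_1,…,v_l)
-- over u_1 > … > u_l > 0 and v_i > 0. Multiply it by [2] = Σ V q^(m V) and expand in two ways.
--   * Insert u = m among the u_i. If m is one of the u_i, then v_i is split as V + (v_i - V),
--     and Σ_V V W(…, v_i - V, …) is a polynomial in v_i when W is a monomial.
--   * In the conjugate coordinates V_j = v_1 + … + v_j, m_j = u_j - u_{j+1} we have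
--     Σ u_i v_i = Σ m_j V_j; insert V among the V_j. If V = V_j, then m_j is split in
--     m_j - 1 ways, which contributes Σ_j (m_j - 1) V_j W = (n - Σ_j V_j) W at q^n.
-- Comparing the two, q d/dq S(W) is a combination of sums S of length l and l + 1 whose weights
-- are polynomials: of degree deg W + 2 in length l, and of degree deg W + 1 in length l + 1.
module Submission where

open import Defs
open import Data.Nat using (ℕ; _+_)
open import Data.Product using (_×_)
open import Algebra.Bundles using (CommutativeSemigroup)
open import Algebra.Properties.CommutativeSemigroup using (interchange)
open import Algebra.Properties.Group using (∙-cancelˡ)
open import Data.Bool using (if_then_else_)
open import Data.Fin using (Fin; zero; suc)
import Data.Integer as ℤ
import Data.Integer.Properties as ℤₚ
open import Data.List as List using (List; []; _∷_; _++_)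
open import Data.List.Relation.Unary.All as All using (All; []; _∷_)
import Data.List.Relation.Unary.All.Properties as Allₚ
open import Data.Nat using (zero; suc; _*_; _∸_; _^_; _≤_; _<_; z≤n; s≤s; NonZero; _≤ᵇ_)
import Data.Nat.Properties as ℕₚ
open import Data.Nat.Tactic.RingSolver using (solve-∀)
open import Data.Product using (Σ; _,_; proj₁; proj₂)
open import Data.Rational as ℚ using (ℚ; 0ℚ; 1ℚ) renaming (_+_ to _✚_; _*_ to _✖_)
import Data.Rational.Properties as ℚₚ
open import Data.Rational.Solver using (module +-*-Solver)
import Data.Rational.Unnormalised as ℚᵘ
import Data.Rational.Unnormalised.Properties as ℚᵘₚ
open import Data.Vec as Vec using (Vec; []; _∷_; head; tail; lookup)
import Data.Vec.Properties as Vecₚ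
open import Data.Vec.Relation.Unary.All using ([]; _∷_)
import Data.Vec.Relation.Unary.All as VecAll
import Data.Vec.Relation.Unary.All.Properties as VecAllₚ
open import Function using (_∘_; flip)
open import Relation.Binary using (Setoid)
open import Relation.Binary.PropositionalEquality
import Relation.Binary.Reasoning.Setoid as SetoidReasoning

-- The natural numbers inside the rationals.

ℚ-+-commutativeSemigroup : CommutativeSemigroup _ _
ℚ-+-commutativeSemigroup = record
  { isCommutativeSemigroup = record { isSemigroup = ℚₚ.+-isSemigroup ; comm = ℚₚ.+-comm } }

val : ℕ → ℚ
val n = ℤ.+ n ℚ./ 1

val-≃ : ∀ n → ℚ.toℚᵘ (val n) ℚᵘ.≃ ℚᵘ.mkℚᵘ (ℤ.+ n) 0
val-≃ n = ℚₚ.toℚᵘ-fromℚᵘ (ℚᵘ.mkℚᵘ (ℤ.+ n) 0)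

val-+ : ∀ m n → val (m + n) ≡ val m ✚ val n
val-+ m n = ℚₚ.toℚᵘ-injective (begin
  ℚ.toℚᵘ (val (m + n))                      ≈⟨ val-≃ (m + n) ⟩
  ℚᵘ.mkℚᵘ (ℤ.+ (m + n)) 0                   ≈⟨ ℚᵘ.*≡* (cong (ℤ._* ℤ.+ 1) (trans (ℤₚ.pos-+ m n)
                                                 (sym (cong₂ ℤ._+_ (ℤₚ.*-identityʳ (ℤ.+ m)) (ℤₚ.*-identityʳ (ℤ.+ n)))))) ⟩
  ℚᵘ.mkℚᵘ (ℤ.+ m) 0 ℚᵘ.+ ℚᵘ.mkℚᵘ (ℤ.+ n) 0  ≈⟨ ℚᵘₚ.+-cong (val-≃ m) (val-≃ n) ⟨
  ℚ.toℚᵘ (val m) ℚᵘ.+ ℚ.toℚᵘ (val n)        ≈⟨ ℚₚ.toℚᵘ-homo-+ (val m) (val n) ⟨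
  ℚ.toℚᵘ (val m ✚ val n)                    ∎)
  where open ℚᵘₚ.≃-Reasoning

val-* : ∀ m n → val (m * n) ≡ val m ✖ val n
val-* m n = ℚₚ.toℚᵘ-injective (begin
  ℚ.toℚᵘ (val (m * n))                      ≈⟨ val-≃ (m * n) ⟩
  ℚᵘ.mkℚᵘ (ℤ.+ (m * n)) 0                   ≈⟨ ℚᵘ.*≡* (cong (ℤ._* ℤ.+ 1) (ℤₚ.pos-* m n)) ⟩
  ℚᵘ.mkℚᵘ (ℤ.+ m) 0 ℚᵘ.* ℚᵘ.mkℚᵘ (ℤ.+ n) 0  ≈⟨ ℚᵘₚ.*-cong (val-≃ m) (val-≃ n) ⟨
  ℚ.toℚᵘ (val m) ℚᵘ.* ℚ.toℚᵘ (val n)        ≈⟨ ℚₚ.toℚᵘ-homo-* (val m) (val n) ⟨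
  ℚ.toℚᵘ (val m ✖ val n)                    ∎)
  where open ℚᵘₚ.≃-Reasoning

-- Finite sums of rationals.

-- Indices start at 1, as in sumFrom1.
sum : ℕ → (ℕ → ℚ) → ℚ
sum zero    f = 0ℚ
sum (suc b) f = sum b f ✚ f (suc b)

sum-cong : ∀ b {f g} → (∀ i → f (suc i) ≡ g (suc i)) → sum b f ≡ sum b g
sum-cong zero    e = refl
sum-cong (suc b) e = cong₂ _✚_ (sum-cong b e) (e b)

sum-0 : ∀ b → sum b (λ _ → 0ℚ) ≡ 0ℚ
sum-0 zero    = refl
sum-0 (suc b) = trans (ℚₚ.+-identityʳ _) (sum-0 b)

sum-+ : ∀ b f g → sum b (λ i → f i ✚ g i) ≡ sum b f ✚ sum b g
sum-+ zero    f g = refl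
sum-+ (suc b) f g = trans (cong (_✚ (f (suc b) ✚ g (suc b))) (sum-+ b f g)) (interchange ℚ-+-commutativeSemigroup (sum b f) (sum b g) _ _)

sum-* : ∀ b c f → sum b (λ i → c ✖ f i) ≡ c ✖ sum b f
sum-* zero    c f = sym (ℚₚ.*-zeroʳ c)
sum-* (suc b) c f = trans (cong (_✚ c ✖ f (suc b)) (sum-* b c f)) (sym (ℚₚ.*-distribˡ-+ c _ _))

sum-swap : ∀ a b (f : ℕ → ℕ → ℚ) → sum a (λ i → sum b (f i)) ≡ sum b (λ j → sum a (λ i → f i j))
sum-swap zero    b f = sym (sum-0 b)
sum-swap (suc a) b f = trans (cong (_✚ sum b (f (suc a))) (sum-swap a b f)) (sym (sum-+ b _ _))

sum-split : ∀ a b f → sum (a + b) f ≡ sum a f ✚ sum b (λ i → f (a + i))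
sum-split a zero    f = trans (cong (λ c → sum c f) (ℕₚ.+-identityʳ a)) (sym (ℚₚ.+-identityʳ _))
sum-split a (suc b) f = begin
  sum (a + suc b) f                                          ≡⟨ cong (λ c → sum c f) (ℕₚ.+-suc a b) ⟩
  sum (a + b) f ✚ f (suc (a + b))                            ≡⟨ cong₂ _✚_ (sum-split a b f) (cong f (sym (ℕₚ.+-suc a b))) ⟩
  sum a f ✚ sum b (λ i → f (a + i)) ✚ f (a + suc b)          ≡⟨ ℚₚ.+-assoc (sum a f) _ _ ⟩
  sum a f ✚ sum (suc b) (λ i → f (a + i))                    ∎
  where open ≡-Reasoning

sum-extend : ∀ b c f → (∀ i → b < i → f i ≡ 0ℚ) → sum (b + c) f ≡ sum b f
sum-extend b c f e = begin
  sum (b + c) f                          ≡⟨ sum-split b c f ⟩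
  sum b f ✚ sum c (λ i → f (b + i))
    ≡⟨ cong (sum b f ✚_) (trans (sum-cong c λ i → e _ (ℕₚ.m<m+n b (s≤s z≤n))) (sum-0 c)) ⟩
  sum b f ✚ 0ℚ                           ≡⟨ ℚₚ.+-identityʳ _ ⟩
  sum b f                                ∎
  where open ≡-Reasoning

-- Trichotomy for a pair of indices: the three summands collect the pairs whose larger entry is the
-- first, both, or the second. Each expansion of the product with [2] starts from this. In the
-- induction, the new row, corner and column are added.
sum-triangle : ∀ b (f : ℕ → ℕ → ℚ) → sum b (λ i → sum b (f i))
  ≡ sum b (λ i → sum (i ∸ 1) (f i) ✚ f i i ✚ sum (i ∸ 1) (λ j → f j i))
sum-triangle zero    f = refl
sum-triangle (suc b) f = begin
  sum b (λ i → sum b (f i) ✚ f i (suc b)) ✚ (sum b (f (suc b)) ✚ d)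
    ≡⟨ cong (_✚ (sum b (f (suc b)) ✚ d)) (sum-+ b _ _) ⟩
  sum b (λ i → sum b (f i)) ✚ sum b (λ i → f i (suc b)) ✚ (sum b (f (suc b)) ✚ d)
    ≡⟨ solve 4 (λ p q r s → p :+ q :+ (r :+ s) := p :+ (r :+ s :+ q)) refl (sum b (λ i → sum b (f i))) (sum b (λ i → f i (suc b))) (sum b (f (suc b))) d ⟩
  sum b (λ i → sum b (f i)) ✚ (sum b (f (suc b)) ✚ d ✚ sum b (λ i → f i (suc b)))
    ≡⟨ cong (_✚ (sum b (f (suc b)) ✚ d ✚ sum b (λ i → f i (suc b)))) (sum-triangle b f) ⟩
  _ ∎
  where
    open ≡-Reasoning
    open +-*-Solver
    d = f (suc b) (suc b)

-- The substitution k = j + z on the pairs j < k. Adding the terms with k ≤ j to both sides turns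
-- the left into the full square; its rows may then run up to j + N, since g vanishes for k > N, and
-- are cut at j.
sum-reindex : ∀ N (g : ℕ → ℕ → ℚ) → (∀ j k → N < k → g (suc j) k ≡ 0ℚ) →
  sum N (λ k → sum (k ∸ 1) (λ j → g j k)) ≡ sum N (λ j → sum N (λ z → g j (j + z)))
sum-reindex N g vanish = ∙-cancelˡ ℚₚ.+-0-group (sum N (λ j → sum j (g j))) _ _ (begin
  sum N (λ j → sum j (g j)) ✚ sum N (λ k → sum (k ∸ 1) (λ j → g j k))
    ≡⟨ sum-+ N _ _ ⟨
  sum N (λ j → sum j (g j) ✚ sum (j ∸ 1) (λ i → g i j))
    ≡⟨ sum-cong N (λ _ → refl) ⟩
  sum N (λ j → sum (j ∸ 1) (g j) ✚ g j j ✚ sum (j ∸ 1) (λ i → g i j))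
    ≡⟨ sum-triangle N g ⟨
  sum N (λ j → sum N (g j))
    ≡⟨ sum-cong N (λ j → sym (trans (sym (cong (λ c → sum c (g (suc j))) (ℕₚ.+-comm N (suc j)))) (sum-extend N (suc j) (g (suc j)) (vanish j)))) ⟩
  sum N (λ j → sum (j + N) (g j))
    ≡⟨ sum-cong N (λ j → sum-split (suc j) N (g (suc j))) ⟩
  sum N (λ j → sum j (g j) ✚ sum N (λ z → g j (j + z)))
    ≡⟨ sum-+ N _ _ ⟩
  sum N (λ j → sum j (g j)) ✚ sum N (λ j → sum N (λ z → g j (j + z))) ∎)
  where
    open ≡-Reasoning

-- Power series and multiplication by powers of q.

infixl 6 _⊕_
infixr 7 _·_

_⊕_ : Series → Series → Series
(F ⊕ G) n = F n ✚ G n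

_·_ : ℚ → Series → Series
(c · F) n = c ✖ F n

∑ : ℕ → (ℕ → Series) → Series
∑ b F n = sum b (λ i → F i n)

constant : ℚ → Series
constant c zero    = c
constant c (suc _) = 0ℚ

-- Multiplication by q^k.
sh : ℕ → Series → Series
sh zero    F n       = F n
sh (suc k) F zero    = 0ℚ
sh (suc k) F (suc n) = sh k F n

Weight : ℕ → Set
Weight l = Vec ℕ l → ℚ

sh-⊕ : ∀ k F G n → sh k (F ⊕ G) n ≡ (sh k F ⊕ sh k G) n
sh-⊕ zero    F G n       = refl
sh-⊕ (suc k) F G zero    = refl
sh-⊕ (suc k) F G (suc n) = sh-⊕ k F G n

sh-· : ∀ k c F n → sh k (c · F) n ≡ (c · sh k F) n
sh-· zero    c F n       = refl
sh-· (suc k) c F zero    = sym (ℚₚ.*-zeroʳ c)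
sh-· (suc k) c F (suc n) = sh-· k c F n

sh-∑ : ∀ k b F n → sh k (∑ b F) n ≡ ∑ b (λ i → sh k (F i)) n
sh-∑ zero    b F n       = refl
sh-∑ (suc k) b F zero    = sym (sum-0 b)
sh-∑ (suc k) b F (suc n) = sh-∑ k b F n

sh-+ : ∀ j k F n → sh (j + k) F n ≡ sh j (sh k F) n
sh-+ zero    k F n       = refl
sh-+ (suc j) k F zero    = refl
sh-+ (suc j) k F (suc n) = sh-+ j k F n

sh-< : ∀ k F {n} → n < k → sh k F n ≡ 0ℚ
sh-< (suc k) F {zero}  _         = refl
sh-< (suc k) F {suc n} (s≤s n<k) = sh-< k F n<k

sh-cong : ∀ k F G n → (∀ m → m ≤ n → F m ≡ G m) → sh k F n ≡ sh k G n
sh-cong zero    F G n       e = e n ℕₚ.≤-refl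
sh-cong (suc k) F G zero    e = refl
sh-cong (suc k) F G (suc n) e = sh-cong k F G n (λ m m≤n → e m (ℕₚ.m≤n⇒m≤1+n m≤n))

-- The Leibniz rule for the product of q^k and F.
dq-sh : ∀ k F n → dq (sh k F) n ≡ (val k · sh k F ⊕ sh k (dq F)) n
dq-sh zero    F n       = sym (trans (cong (_✚ dq F n) (ℚₚ.*-zeroˡ (F n))) (ℚₚ.+-identityˡ _))
dq-sh (suc k) F zero    = sym (trans (ℚₚ.+-identityʳ _) (ℚₚ.*-zeroʳ (val (suc k))))
dq-sh (suc k) F (suc n) = begin
  val (suc n) ✖ s                   ≡⟨ cong (_✖ s) (val-+ 1 n) ⟩
  (1ℚ ✚ val n) ✖ s                  ≡⟨ solve 2 (λ x y → (con 1ℚ :+ x) :* y := y :+ x :* y) refl (val n) s ⟩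
  s ✚ val n ✖ s                     ≡⟨ cong (s ✚_) (dq-sh k F n) ⟩
  s ✚ (val k ✖ s ✚ t)               ≡⟨ solve 3 (λ x y z → y :+ (x :* y :+ z) := (con 1ℚ :+ x) :* y :+ z) refl (val k) s t ⟩
  (1ℚ ✚ val k) ✖ s ✚ t              ≡⟨ cong (λ c → c ✖ s ✚ t) (val-+ 1 k) ⟨
  val (suc k) ✖ s ✚ t               ∎
  where
    open ≡-Reasoning
    open +-*-Solver
    s = sh k F n
    t = sh k (dq F) n

-- Monomial weights and the weights of the two expansions.

mono : ∀ {l} → Vec ℕ l → Weight l
mono []       []       = 1ℚ
mono (r ∷ rs) (v ∷ vs) = val (v ^ r) ✖ mono rs vs

-- The weights in the two expansions of [2] · S(W), with V_j = a + v_1 + … + v_j: insertU and splitV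
-- for u = m new among, or equal to one of, the u_i; insertV for V new among the V_j, and
-- partialSums for Σ_j V_j W, the amount by which Σ_j (m_j - 1) V_j W falls short of n W.
insertU : ∀ l → Weight l → Weight (suc l)
insertU zero    W (x ∷ vs) = val x ✖ W vs
insertU (suc l) W (x ∷ vs) = val x ✖ W vs ✚ insertU l (W ∘ (x ∷_)) vs

splitV : ∀ l → Weight l → Weight l
splitV zero    W _        = 0ℚ
splitV (suc l) W (x ∷ vs) = sum (x ∸ 1) (λ v → val v ✖ W ((x ∸ v) ∷ vs)) ✚ splitV l (W ∘ (x ∷_)) vs

partialSums : ∀ l → ℕ → Weight l → Weight l
partialSums zero    a W _        = 0ℚ
partialSums (suc l) a W (x ∷ vs) = val (a + x) ✖ W (x ∷ vs) ✚ partialSums l (a + x) (W ∘ (x ∷_)) vs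

insertV : ∀ l → ℕ → Weight l → Weight (suc l)
insertV zero    a W (x ∷ vs) = val (a + x) ✖ W vs
insertV (suc l) a W (x ∷ vs) = val (a + x) ✖ W ((x + head vs) ∷ tail vs) ✚ insertV l (a + x) (W ∘ (x ∷_)) vs

val-sumFrom1 : ∀ b f → val (sumFrom1 b f) ≡ sum b (val ∘ f)
val-sumFrom1 zero    f = refl
val-sumFrom1 (suc b) f = trans (val-+ (sumFrom1 b f) (f (suc b))) (cong (_✚ val (f (suc b))) (val-sumFrom1 b f))

-- Matches the test in `sig`: where the natural subtraction n - k would be cut off at 0, the shifted
-- series has coefficient 0.
sh-if : ∀ k n (F : Series) (f : ℕ → ℕ) → (∀ m → m ≤ n → F m ≡ val (f m)) →
  sh k F n ≡ val (if k ≤ᵇ n then f (n ∸ k) else 0)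
sh-if zero          n       F f e = e n ℕₚ.≤-refl
sh-if (suc k)       zero    F f e = refl
-- The case k = 1 stands alone because `_≤ᵇ_` unfolds to a strict comparison, which is decided at 0.
sh-if (suc zero)    (suc n) F f e = e n (ℕₚ.n≤1+n n)
sh-if (suc (suc k)) (suc n) F f e = sh-if (suc k) n F f (λ m m≤n → e m (ℕₚ.m≤n⇒m≤1+n m≤n))

-- Series modulo q^(N+1).

-- Up to q^N all indices may be bounded by N, so that every sum is finite.
module Truncated (N : ℕ) where

  infix 4 _≈_
  record _≈_ (F G : Series) : Set where
    constructor upTo
    field at : ∀ n → n ≤ N → F n ≡ G n
  open _≈_ public

  ≈-setoid : Setoid _ _
  ≈-setoid = record
    { Carrier = Series ; _≈_ = _≈_
    ; isEquivalence = record
      { refl = upTo λ _ _ → refl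
      ; sym = λ p → upTo λ n h → sym (at p n h)
      ; trans = λ p q → upTo λ n h → trans (at p n h) (at q n h) } }

  open Setoid ≈-setoid using () renaming (refl to ≈-refl; sym to ≈-sym; trans to ≈-trans)
  open SetoidReasoning ≈-setoid

  exact : ∀ {F G : Series} → (∀ n → F n ≡ G n) → F ≈ G
  exact e = upTo λ n _ → e n

  ⊕-cong : ∀ {F F′ G G′} → F ≈ F′ → G ≈ G′ → F ⊕ G ≈ F′ ⊕ G′
  ⊕-cong p q = upTo λ n h → cong₂ _✚_ (at p n h) (at q n h)

  ·-cong : ∀ c {F G} → F ≈ G → c · F ≈ c · G
  ·-cong c p = upTo λ n h → cong (c ✖_) (at p n h)

  ∑-cong : ∀ b {F G : ℕ → Series} → (∀ i → F (suc i) ≈ G (suc i)) → ∑ b F ≈ ∑ b G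
  ∑-cong b e = upTo λ n h → sum-cong b (λ i → at (e i) n h)

  sh-≈ : ∀ k {F G} → F ≈ G → sh k F ≈ sh k G
  sh-≈ k {F} {G} p = upTo λ n h → sh-cong k F G n (λ m m≤n → at p m (ℕₚ.≤-trans m≤n h))

  dq-cong : ∀ {F G} → F ≈ G → dq F ≈ dq G
  dq-cong p = upTo λ n h → cong (val n ✖_) (at p n h)

  sh-vanish : ∀ {k} F → N < k → sh k F ≈ (λ _ → 0ℚ)
  sh-vanish F N<k = upTo λ n n≤N → sh-< _ F (ℕₚ.≤-<-trans n≤N N<k)

  ∑-⊕ : ∀ b (F G : ℕ → Series) → ∑ b (λ i → F i ⊕ G i) ≈ ∑ b F ⊕ ∑ b G
  ∑-⊕ b F G = exact λ n → sum-+ b (λ i → F i n) (λ i → G i n)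

  ∑-· : ∀ b c (F : ℕ → Series) → ∑ b (λ i → c · F i) ≈ c · ∑ b F
  ∑-· b c F = exact λ n → sum-* b c (λ i → F i n)

  ∑-swap : ∀ a b (F : ℕ → ℕ → Series) → ∑ a (λ i → ∑ b (F i)) ≈ ∑ b (λ j → ∑ a (λ i → F i j))
  ∑-swap a b F = exact λ n → sum-swap a b (λ i j → F i j n)

  triangle : ∀ b (F : ℕ → ℕ → Series) → ∑ b (λ i → ∑ b (F i))
    ≈ ∑ b (λ i → ∑ (i ∸ 1) (F i) ⊕ F i i ⊕ ∑ (i ∸ 1) (λ j → F j i))
  triangle b F = exact λ n → sum-triangle b (λ i j → F i j n)

  ∑-vanish : ∀ b {F : ℕ → Series} → (∀ i → F (suc i) ≈ λ _ → 0ℚ) → ∑ b F ≈ λ _ → 0ℚ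
  ∑-vanish b e = ≈-trans (∑-cong b e) (exact λ n → sum-0 b)

  reindex : ∀ (G : ℕ → ℕ → Series) → (∀ j k → N < k → G (suc j) k ≈ λ _ → 0ℚ) →
    ∑ N (λ k → ∑ (k ∸ 1) (λ j → G j k)) ≈ ∑ N (λ j → ∑ N (λ z → G j (j + z)))
  reindex G vanish = upTo λ n h → sum-reindex N (λ j k → G j k n) (λ j k lt → at (vanish j k lt) n h)

  -- Linear operators commuting with multiplication by q.

  -- Abstracts the properties of multiplication by a fixed series that are used below: such an
  -- operator passes through the sums and shifts of which the nested sums are built.
  record Linear (L : Series → Series) : Set where
    field
      ≈-cong : ∀ {F G} → F ≈ G → L F ≈ L G
      ⊕-hom  : ∀ F G → L (F ⊕ G) ≈ L F ⊕ L G
      ·-hom  : ∀ c F → L (c · F) ≈ c · L F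
      sh-hom : ∀ k F → L (sh k F) ≈ sh k (L F)

    ∑-hom : ∀ b F → L (∑ b F) ≈ ∑ b (L ∘ F)
    -- Homogeneity at the scalar 0 shows that L preserves the zero series.
    ∑-hom zero    F = begin
      L (λ _ → 0ℚ)            ≈⟨ ≈-cong (exact λ _ → sym (ℚₚ.*-zeroˡ 0ℚ)) ⟩
      L (0ℚ · (λ _ → 0ℚ))     ≈⟨ ·-hom 0ℚ (λ _ → 0ℚ) ⟩
      0ℚ · L (λ _ → 0ℚ)       ≈⟨ exact (λ n → ℚₚ.*-zeroˡ (L (λ _ → 0ℚ) n)) ⟩
      (λ _ → 0ℚ)              ∎
    ∑-hom (suc b) F = ≈-trans (⊕-hom (∑ b F) (F (suc b))) (⊕-cong (∑-hom b F) ≈-refl)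

  open Linear

  sh-comm : ∀ j k F n → sh j (sh k F) n ≡ sh k (sh j F) n
  sh-comm j k F n = trans (sym (sh-+ j k F n)) (trans (cong (λ c → sh c F n) (ℕₚ.+-comm j k)) (sh-+ k j F n))

  sh-linear : ∀ k → Linear (sh k)
  sh-linear k = record
    { ≈-cong = sh-≈ k ; ⊕-hom = λ F G → exact (sh-⊕ k F G)
    ; ·-hom = λ c F → exact (sh-· k c F) ; sh-hom = λ j F → exact (sh-comm k j F) }

  ·-linear : ∀ c {L} → Linear L → Linear (λ F → c · L F)
  ·-linear c {L} lin = record
    { ≈-cong = λ p → ·-cong c (≈-cong lin p)
    ; ⊕-hom = λ F G → ≈-trans (·-cong c (⊕-hom lin F G)) (exact λ n → ℚₚ.*-distribˡ-+ c (L F n) (L G n))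
    ; ·-hom = λ d F → ≈-trans (·-cong c (·-hom lin d F)) (exact λ n → solve 3 (λ x y z → x :* (y :* z) := y :* (x :* z)) refl c d (L F n))
    ; sh-hom = λ k F → ≈-trans (·-cong c (sh-hom lin k F)) (≈-sym (exact (sh-· k c (L F)))) }
    where open +-*-Solver

  ∑-linear : ∀ b {L : ℕ → Series → Series} → (∀ i → Linear (L i)) → Linear (λ F → ∑ b (λ i → L i F))
  ∑-linear b {L} lin = record
    { ≈-cong = λ p → ∑-cong b (λ i → ≈-cong (lin (suc i)) p)
    ; ⊕-hom = λ F G → ≈-trans (∑-cong b (λ i → ⊕-hom (lin (suc i)) F G)) (∑-⊕ b (λ i → L i F) (λ i → L i G))
    ; ·-hom = λ c F → ≈-trans (∑-cong b (λ i → ·-hom (lin (suc i)) c F)) (∑-· b c (λ i → L i F))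
    ; sh-hom = λ k F → ≈-trans (∑-cong b (λ i → sh-hom (lin (suc i)) k F)) (≈-sym (exact (sh-∑ k b (λ i → L i F)))) }

  constant-cong : ∀ {c d} → c ≡ d → ∀ n → constant c n ≡ constant d n
  constant-cong refl n = refl

  constant-⊕ : ∀ c d n → constant (c ✚ d) n ≡ (constant c ⊕ constant d) n
  constant-⊕ c d zero    = refl
  constant-⊕ c d (suc n) = refl

  constant-· : ∀ c d n → constant (c ✖ d) n ≡ (c · constant d) n
  constant-· c d zero    = refl
  constant-· c d (suc n) = sym (ℚₚ.*-zeroʳ c)

  -- Nested sums.

  -- Multiple sums with one state variable: b ↦ u ∸ 1 for the bound on the next u
  -- in S, and a ↦ a + v for the partial sum of the v's in R.
  module Nested (bound : ℕ → ℕ) (expo : ℕ → ℕ → ℕ → ℕ) (next : ℕ → ℕ → ℕ → ℕ) where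

    T : ∀ l → Weight l → ℕ → Series
    T zero    W s = constant (W [])
    T (suc l) W s = ∑ (bound s) λ u → ∑ N λ v → sh (expo s u v) (T l (W ∘ (v ∷_)) (next s u v))

    T-cong : ∀ l {W W′ : Weight l} s → (∀ v → W v ≡ W′ v) → T l W s ≈ T l W′ s
    T-cong zero    s e = exact (constant-cong (e []))
    T-cong (suc l) s e = ∑-cong (bound s) λ u → ∑-cong N λ v → sh-≈ (expo s _ _) (T-cong l _ (λ vs → e (suc v ∷ vs)))

    T-⊕ : ∀ l (W W′ : Weight l) s → T l (λ v → W v ✚ W′ v) s ≈ T l W s ⊕ T l W′ s
    T-⊕ zero    W W′ s = exact (constant-⊕ (W []) (W′ []))
    T-⊕ (suc l) W W′ s = begin
      T (suc l) (λ v → W v ✚ W′ v) s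
        ≈⟨ ∑-cong (bound s) (λ u → ∑-cong N λ v → ≈-trans (sh-≈ (expo s _ _) (T-⊕ l _ _ _)) (exact (sh-⊕ (expo s _ _) _ _))) ⟩
      ∑ (bound s) (λ u → ∑ N λ v → t W u v ⊕ t W′ u v)
        ≈⟨ ∑-cong (bound s) (λ u → ∑-⊕ N _ _) ⟩
      ∑ (bound s) (λ u → ∑ N (t W u) ⊕ ∑ N (t W′ u))
        ≈⟨ ∑-⊕ (bound s) _ _ ⟩
      T (suc l) W s ⊕ T (suc l) W′ s ∎
      where
        t : Weight (suc l) → ℕ → ℕ → Series
        t W u v = sh (expo s u v) (T l (W ∘ (v ∷_)) (next s u v))

    T-· : ∀ l c (W : Weight l) s → T l (λ v → c ✖ W v) s ≈ c · T l W s
    T-· zero    c W s = exact (constant-· c (W []))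
    T-· (suc l) c W s = begin
      T (suc l) (λ v → c ✖ W v) s
        ≈⟨ ∑-cong (bound s) (λ u → ∑-cong N λ v → ≈-trans (sh-≈ (expo s _ _) (T-· l c _ _)) (exact (sh-· (expo s _ _) c _))) ⟩
      ∑ (bound s) (λ u → ∑ N λ v → c · t u v)
        ≈⟨ ∑-cong (bound s) (λ u → ∑-· N c _) ⟩
      ∑ (bound s) (λ u → c · ∑ N (t u))
        ≈⟨ ∑-· (bound s) c _ ⟩
      c · T (suc l) W s ∎
      where
        t : ℕ → ℕ → Series
        t u v = sh (expo s u v) (T l (W ∘ (v ∷_)) (next s u v))

    T-0 : ∀ l s → T l (λ _ → 0ℚ) s ≈ λ _ → 0ℚ
    T-0 l s = begin
      T l (λ _ → 0ℚ) s            ≈⟨ T-cong l s (λ _ → sym (ℚₚ.*-zeroˡ 0ℚ)) ⟩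
      T l (λ _ → 0ℚ ✖ 0ℚ) s       ≈⟨ T-· l 0ℚ (λ _ → 0ℚ) s ⟩
      0ℚ · T l (λ _ → 0ℚ) s       ≈⟨ exact (λ n → ℚₚ.*-zeroˡ (T l (λ _ → 0ℚ) s n)) ⟩
      (λ _ → 0ℚ)                  ∎

    T-sum : ∀ l b (W : ℕ → Weight l) s → T l (λ v → sum b (λ i → W i v)) s ≈ ∑ b (λ i → T l (W i) s)
    T-sum l zero    W s = T-0 l s
    T-sum l (suc b) W s = ≈-trans (T-⊕ l _ (W (suc b)) s) (⊕-cong (T-sum l b W s) ≈-refl)

  open Nested (λ b → b) (λ _ u v → u * v) (λ _ u _ → u ∸ 1) public
    renaming (T to S; T-cong to S-cong; T-⊕ to S-⊕; T-· to S-·; T-0 to S-0; T-sum to S-sum)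

  open Nested (λ _ → N) (λ a m v → m * (a + v)) (λ a _ v → a + v) public
    using () renaming (T to R; T-⊕ to R-⊕; T-· to R-·)

  -- First expansion of the product with [2].

  -- Multiplication by the bracket [2], with u ≤ b in P and V > a in Q.
  P : ℕ → Series → Series
  P b F = ∑ b λ u → ∑ N λ v → val v · sh (u * v) F

  P₁ : ℕ → Series → Series
  P₁ u F = ∑ N λ v → val v · sh (u * v) F

  P₁-linear : ∀ u → Linear (P₁ u)
  P₁-linear u = ∑-linear N (λ v → ·-linear (val v) (sh-linear (u * v)))

  P-linear : ∀ b → Linear (P b)
  P-linear b = ∑-linear b P₁-linear

  ⊕-interchange : ∀ F G H K → (F ⊕ G) ⊕ (H ⊕ K) ≈ (F ⊕ H) ⊕ (G ⊕ K)
  ⊕-interchange F G H K = exact λ n → interchange ℚ-+-commutativeSemigroup (F n) (G n) (H n) (K n)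

  -- Induction on l, comparing the new m with u_1. If m > u_1, it becomes the first index; if m =
  -- u_1, then v_1 is split; if m < u_1, it is inserted into the inner sum, whose indices are also
  -- bounded by u_1 - 1. For this last case the operator `P` carries a bound.
  u-expansion : ∀ l (W : Weight l) b → P b (S l W b) ≈ S (suc l) (insertU l W) b ⊕ S l (splitV l W) b
  u-expansion zero W b = begin
    P b (constant (W []))
      ≈⟨ ∑-cong b (λ u → ∑-cong N λ v → ≈-trans (≈-sym (exact (sh-· (suc u * suc v) (val (suc v)) (constant (W [])))))
           (sh-≈ (suc u * suc v) (≈-sym (exact (constant-· (val (suc v)) (W [])))))) ⟩
    S 1 (insertU 0 W) b
      ≈⟨ exact (λ n → sym (ℚₚ.+-identityʳ _)) ⟩
    S 1 (insertU 0 W) b ⊕ (λ _ → 0ℚ)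
      ≈⟨ ⊕-cong (≈-refl {S 1 (insertU 0 W) b}) (≈-sym (S-0 0 b)) ⟩
    S 1 (insertU 0 W) b ⊕ S 0 (splitV 0 W) b ∎
  u-expansion (suc l) W b = begin
    P b (∑ b C)
      ≈⟨ ∑-cong b (λ u → ∑-hom (P₁-linear (suc u)) b C) ⟩
    ∑ b (λ u → ∑ b (λ u′ → P₁ u (C u′)))
      ≈⟨ triangle b (λ u u′ → P₁ u (C u′)) ⟩
    ∑ b (λ u → ∑ (u ∸ 1) (λ u′ → P₁ u (C u′)) ⊕ P₁ u (C u) ⊕ P (u ∸ 1) (C u))
      ≈⟨ ∑-cong b (λ u → ⊕-cong (⊕-cong (larger u) (equal u)) (smaller u)) ⟩
    ∑ b (λ u → (∑ N (X u) ⊕ ∑ N (Y u)) ⊕ (∑ N (Z u) ⊕ ∑ N (V u)))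
      ≈⟨ ∑-cong b (λ u → ⊕-interchange (∑ N (X (suc u))) (∑ N (Y (suc u))) (∑ N (Z (suc u))) (∑ N (V (suc u)))) ⟩
    ∑ b (λ u → (∑ N (X u) ⊕ ∑ N (Z u)) ⊕ (∑ N (Y u) ⊕ ∑ N (V u)))
      ≈⟨ ∑-⊕ b _ _ ⟩
    ∑ b (λ u → ∑ N (X u) ⊕ ∑ N (Z u)) ⊕ ∑ b (λ u → ∑ N (Y u) ⊕ ∑ N (V u))
      ≈⟨ ⊕-cong (∑-cong b λ u → ≈-trans (≈-sym (∑-⊕ N _ _)) (∑-cong N λ v →
                  merge (suc l) (λ vs → val (suc v) ✖ W vs) (insertU l (W ∘ (suc v ∷_))) u v))
                (∑-cong b λ u → ≈-trans (≈-sym (∑-⊕ N _ _)) (∑-cong N λ v →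
                  merge l (λ vs → sum v λ i → val i ✖ W ((suc v ∸ i) ∷ vs)) (splitV l (W ∘ (suc v ∷_))) u v)) ⟩
    S (suc (suc l)) (insertU (suc l) W) b ⊕ S (suc l) (splitV (suc l) W) b ∎
    where
      C : ℕ → Series
      C u = ∑ N λ v → sh (u * v) (S l (W ∘ (v ∷_)) (u ∸ 1))
      -- `X` and `Z` carry the two summands of `insertU (suc l) W`, `Y` and `V` those of
      -- `splitV (suc l) W`.
      X Y Z V : ℕ → ℕ → Series
      X u v = sh (u * v) (S (suc l) (λ vs → val v ✖ W vs) (u ∸ 1))
      Y u x = sh (u * x) (S l (λ vs → sum (x ∸ 1) λ v → val v ✖ W ((x ∸ v) ∷ vs)) (u ∸ 1))
      Z u v = sh (u * v) (S (suc l) (insertU l (W ∘ (v ∷_))) (u ∸ 1))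
      V u v = sh (u * v) (S l (splitV l (W ∘ (v ∷_))) (u ∸ 1))

      merge : ∀ l (W W′ : Weight l) u v →
        sh (suc u * suc v) (S l W u) ⊕ sh (suc u * suc v) (S l W′ u)
          ≈ sh (suc u * suc v) (S l (λ vs → W vs ✚ W′ vs) u)
      merge l W W′ u v = ≈-trans (≈-sym (exact (sh-⊕ (suc u * suc v) _ _))) (sh-≈ (suc u * suc v) (≈-sym (S-⊕ l W W′ u)))

      larger : ∀ u → ∑ u (λ u′ → P₁ (suc u) (C u′)) ≈ ∑ N (X (suc u))
      larger u = begin
        ∑ u (λ u′ → P₁ (suc u) (C u′))    ≈⟨ ∑-hom (P₁-linear (suc u)) u C ⟨
        P₁ (suc u) (S (suc l) W u)        ≈⟨ ∑-cong N (λ v → ≈-sym (exact (sh-· (suc u * suc v) (val (suc v)) _))) ⟩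
        ∑ N (λ v → sh (suc u * v) (val v · S (suc l) W u))
          ≈⟨ ∑-cong N (λ v → sh-≈ (suc u * suc v) (≈-sym (S-· (suc l) (val (suc v)) W u))) ⟩
        ∑ N (X (suc u)) ∎

      smaller : ∀ u → P u (C (suc u)) ≈ ∑ N (Z (suc u)) ⊕ ∑ N (V (suc u))
      smaller u = begin
        P u (C (suc u))
          ≈⟨ ∑-hom (P-linear u) N _ ⟩
        ∑ N (λ v → P u (sh (suc u * v) (S l (W ∘ (v ∷_)) u)))
          ≈⟨ ∑-cong N (λ v → ≈-trans (sh-hom (P-linear u) (suc u * suc v) _) (sh-≈ (suc u * suc v) (u-expansion l (W ∘ (suc v ∷_)) u))) ⟩
        ∑ N (λ v → sh (suc u * v) (S (suc l) (insertU l (W ∘ (v ∷_))) u ⊕ S l (splitV l (W ∘ (v ∷_))) u))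
          ≈⟨ ∑-cong N (λ v → exact (sh-⊕ (suc u * suc v) _ _)) ⟩
        ∑ N (λ v → Z (suc u) v ⊕ V (suc u) v)
          ≈⟨ ∑-⊕ N _ _ ⟩
        ∑ N (Z (suc u)) ⊕ ∑ N (V (suc u)) ∎

      -- The exponent u v + u z depends on x = v + z alone, so the double sum is reindexed by v < x
      -- with z = x - v. Terms with x > N vanish because u x ≥ x.
      equal : ∀ u → P₁ (suc u) (C (suc u)) ≈ ∑ N (Y (suc u))
      equal u = begin
        P₁ (suc u) (C (suc u))
          ≈⟨ ∑-cong N (λ v → ∑-hom (·-linear (val (suc v)) (sh-linear (suc u * suc v))) N _) ⟩
        ∑ N (λ v → ∑ N λ z → val v · sh (suc u * v) (sh (suc u * z) (S l (W ∘ (z ∷_)) u)))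
          ≈⟨ ∑-cong N (λ v → ∑-cong N λ z → ·-cong (val (suc v)) (exact (shift v z))) ⟩
        ∑ N (λ v → ∑ N λ z → G v (v + z))
          ≈⟨ reindex G (λ j k N<k → ≈-trans (·-cong (val (suc j)) (sh-vanish _ (ℕₚ.<-≤-trans N<k (ℕₚ.m≤n*m k (suc u)))))
               (exact λ _ → ℚₚ.*-zeroʳ (val (suc j)))) ⟨
        ∑ N (λ x → ∑ (x ∸ 1) λ v → G v x)
          ≈⟨ ∑-cong N (λ x → collect x) ⟩
        ∑ N (Y (suc u)) ∎
        where
          G : ℕ → ℕ → Series
          G v x = val v · sh (suc u * x) (S l (W ∘ ((x ∸ v) ∷_)) u)

          shift : ∀ v z n → sh (suc u * suc v) (sh (suc u * suc z) (S l (W ∘ (suc z ∷_)) u)) n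
            ≡ sh (suc u * (suc v + suc z)) (S l (W ∘ ((suc v + suc z ∸ suc v) ∷_)) u) n
          shift v z n = trans (sym (sh-+ (suc u * suc v) (suc u * suc z) _ n))
            (cong₂ (λ k y → sh k (S l (W ∘ (y ∷_)) u) n) (sym (ℕₚ.*-distribˡ-+ (suc u) (suc v) (suc z)))
              (sym (ℕₚ.m+n∸m≡n (suc v) (suc z))))

          collect : ∀ x → ∑ x (λ v → G v (suc x)) ≈ Y (suc u) (suc x)
          collect x = begin
            ∑ x (λ v → G v (suc x))
              ≈⟨ ∑-cong x (λ v → ≈-trans (≈-sym (exact (sh-· (suc u * suc x) (val (suc v)) _)))
                   (sh-≈ (suc u * suc x) (≈-sym (S-· l (val (suc v)) _ u)))) ⟩
            ∑ x (λ v → sh (suc u * suc x) (S l (λ vs → val v ✖ W ((suc x ∸ v) ∷ vs)) u))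
              ≈⟨ exact (λ n → sh-∑ (suc u * suc x) x _ n) ⟨
            sh (suc u * suc x) (∑ x (λ v → S l (λ vs → val v ✖ W ((suc x ∸ v) ∷ vs)) u))
              ≈⟨ sh-≈ (suc u * suc x) (S-sum l x _ u) ⟨
            Y (suc u) (suc x) ∎

  -- Conjugation.

  -- One step of Abel summation, with V_1 = a + v, u = u_2 and m = u_1 - u_2: the gap m is traded
  -- for u_1 = u + m, and V_2 for the difference v′.
  expo-split : ∀ m u a v v′ → m * (a + v) + u * (a + v + v′) ≡ (u + m) * (a + v) + u * v′
  expo-split = solve-∀

  -- Conjugation one corner at a time: the first u is the first m plus the u that follows it.
  R-suc : ∀ l (W : Weight (suc l)) a →
    R (suc l) W a ≈ ∑ N λ u → ∑ N λ v → sh (u * (a + v)) (S l (W ∘ (v ∷_)) (u ∸ 1))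
  R-suc zero    W a = ≈-refl
  R-suc (suc l) W a = begin
    R (suc (suc l)) W a
      ≈⟨ ∑-cong N (λ m → ∑-cong N λ v → ≈-trans
           (sh-≈ (suc m * (a + suc v)) (R-suc l (W ∘ (suc v ∷_)) (a + suc v)))
           (regroup (suc m) (suc v))) ⟩
    ∑ N (λ m → ∑ N λ v → ∑ N λ u → G v u (u + m))
      ≈⟨ ∑-swap N N _ ⟩
    ∑ N (λ v → ∑ N λ m → ∑ N λ u → G v u (u + m))
      -- The pairs (u_2, gap) become the pairs u_2 < u_1. Those with u_1 > N drop out because the
      -- exponent is at least u_1 (a + v) ≥ u_1.
      ≈⟨ ∑-cong N (λ v → ≈-trans (∑-swap N N _) (≈-sym (reindex (G (suc v))
           λ j k N<k → sh-vanish (D (suc v) (suc j)) (ℕₚ.<-≤-trans N<k (k≤k*w v k))))) ⟩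
    ∑ N (λ v → ∑ N λ u → ∑ (u ∸ 1) λ u′ → G v u′ u)
      ≈⟨ ∑-cong N (λ v → ∑-cong N λ u → ≈-sym (exact (sh-∑ (suc u * (a + suc v)) u (D (suc v))))) ⟩
    ∑ N (λ v → ∑ N λ u → sh (u * (a + v)) (S (suc l) (W ∘ (v ∷_)) (u ∸ 1)))
      ≈⟨ ∑-swap N N _ ⟩
    ∑ N (λ u → ∑ N λ v → sh (u * (a + v)) (S (suc l) (W ∘ (v ∷_)) (u ∸ 1))) ∎
    where
      D : ℕ → ℕ → Series
      D v u = ∑ N λ v′ → sh (u * v′) (S l (W ∘ (v ∷_) ∘ (v′ ∷_)) (u ∸ 1))

      G : ℕ → ℕ → ℕ → Series
      G v u′ u = sh (u * (a + v)) (D v u′)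

      k≤k*w : ∀ v k → k ≤ k * (a + suc v)
      k≤k*w v k rewrite ℕₚ.+-suc a v = ℕₚ.m≤m*n k (suc (a + v))

      regroup : ∀ m v → sh (m * (a + v)) (∑ N λ u → ∑ N λ v′ → sh (u * (a + v + v′)) (S l (W ∘ (v ∷_) ∘ (v′ ∷_)) (u ∸ 1)))
        ≈ ∑ N λ u → G v u (u + m)
      regroup m v = ≈-trans (exact (sh-∑ (m * (a + v)) N _)) (∑-cong N λ u → begin
        sh (m * (a + v)) (∑ N λ v′ → sh (suc u * (a + v + v′)) (s u v′))
          ≈⟨ exact (sh-∑ (m * (a + v)) N _) ⟩
        ∑ N (λ v′ → sh (m * (a + v)) (sh (suc u * (a + v + v′)) (s u v′)))
          ≈⟨ ∑-cong N (λ v′ → exact (combine u (suc v′))) ⟩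
        ∑ N (λ v′ → sh ((suc u + m) * (a + v)) (sh (suc u * v′) (s u v′)))
          ≈⟨ exact (sh-∑ ((suc u + m) * (a + v)) N _) ⟨
        G v (suc u) (suc u + m) ∎)
        where
          s : ℕ → ℕ → Series
          s u v′ = S l (W ∘ (v ∷_) ∘ (v′ ∷_)) u

          combine : ∀ u v′ n → sh (m * (a + v)) (sh (suc u * (a + v + v′)) (s u v′)) n
            ≡ sh ((suc u + m) * (a + v)) (sh (suc u * v′) (s u v′)) n
          combine u v′ n = trans (sym (sh-+ (m * (a + v)) (suc u * (a + v + v′)) (s u v′) n))
            (trans (cong (λ k → sh k (s u v′) n) (expo-split m (suc u) a v v′))
              (sh-+ ((suc u + m) * (a + v)) (suc u * v′) (s u v′) n))

  R≈S : ∀ l (W : Weight l) → R l W 0 ≈ S l W N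
  R≈S zero    W = ≈-refl
  R≈S (suc l) W = R-suc l W 0

  -- Second expansion of the product with [2].

  Q₁ : ℕ → Series → Series
  Q₁ w F = ∑ N λ m → val w · sh (m * w) F

  Q : ℕ → Series → Series
  Q a F = ∑ N λ x → Q₁ (a + x) F

  Q₁-linear : ∀ w → Linear (Q₁ w)
  Q₁-linear w = ∑-linear N (λ m → ·-linear (val w) (sh-linear (m * w)))

  Q-linear : ∀ a → Linear (Q a)
  Q-linear a = ∑-linear N (λ x → Q₁-linear (a + x))

  dq-∑ : ∀ b F → dq (∑ b F) ≈ ∑ b (dq ∘ F)
  dq-∑ b F = exact λ n → sym (sum-* b (val n) (λ i → F i n))

  -- The k equal terms stand for the splittings of k + 1 into two positive parts, and the extra c is
  -- the term that `partialSums` supplies.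
  val-suc-* : ∀ k c → val (suc k) ✖ c ≡ sum k (λ _ → c) ✚ c
  val-suc-* zero    c = trans (ℚₚ.*-identityˡ c) (sym (ℚₚ.+-identityˡ c))
  val-suc-* (suc k) c = trans (cong (_✖ c) (val-+ 1 (suc k)))
    (trans (solve 2 (λ x c → (con 1ℚ :+ x) :* c := x :* c :+ c) refl (val (suc k)) c) (cong (_✚ c) (val-suc-* k c)))
    where open +-*-Solver

  Q₁-vanish : ∀ {w} F → N < w → Q₁ w F ≈ λ _ → 0ℚ
  Q₁-vanish {w} F N<w = ∑-vanish N λ m → ≈-trans
    (·-cong (val w) (sh-vanish F (ℕₚ.<-≤-trans N<w (ℕₚ.m≤n*m w (suc m)))))
    (exact λ _ → ℚₚ.*-zeroʳ (val w))

  dq-constant : ∀ c → dq (constant c) ≈ λ _ → 0ℚ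
  dq-constant c = exact λ { zero → ℚₚ.*-zeroˡ c ; (suc n) → ℚₚ.*-zeroʳ (val (suc n)) }

  -- Induction on l, comparing the new V with V_1 = a + v_1. If V > V_1, it passes to the inner sum
  -- with offset V_1; if V = V_1, then m_1 is split in m_1 - 1 ways; if V < V_1, it becomes the
  -- first partial sum. The term V_1 W of `partialSums` completes the middle case to m_1 V_1, the
  -- factor that d produces from q^(m_1 V_1).
  V-expansion : ∀ l a (W : Weight l) →
    Q a (R l W a) ⊕ R l (partialSums l a W) a ≈ dq (R l W a) ⊕ R (suc l) (insertV l a W) a
  V-expansion zero a W = begin
    Q a (constant (W [])) ⊕ constant 0ℚ
      ≈⟨ exact (λ { zero → ℚₚ.+-identityʳ _ ; (suc n) → ℚₚ.+-identityʳ _ }) ⟩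
    Q a (constant (W []))
      ≈⟨ ∑-swap N N _ ⟩
    ∑ N (λ m → ∑ N λ x → val (a + x) · sh (m * (a + x)) (constant (W [])))
      ≈⟨ ∑-cong N (λ m → ∑-cong N λ x → ≈-trans (≈-sym (exact (sh-· (suc m * (a + suc x)) (val (a + suc x)) (constant (W [])))))
           (sh-≈ (suc m * (a + suc x)) (≈-sym (exact (constant-· (val (a + suc x)) (W [])))))) ⟩
    R 1 (insertV 0 a W) a
      ≈⟨ exact (λ { zero → ℚₚ.+-identityˡ _ ; (suc n) → ℚₚ.+-identityˡ _ }) ⟨
    (λ _ → 0ℚ) ⊕ R 1 (insertV 0 a W) a
      ≈⟨ ⊕-cong (dq-constant (W [])) (≈-refl {R 1 (insertV 0 a W) a}) ⟨
    dq (constant (W [])) ⊕ R 1 (insertV 0 a W) a ∎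
  V-expansion (suc l) a W = begin
    Q a (R (suc l) W a) ⊕ R (suc l) (partialSums (suc l) a W) a
      ≈⟨ ⊕-cong lhs (∑-swap N N _) ⟩
    ∑ N (λ j → ∑ N (lo j) ⊕ ∑ N (eq j) ⊕ ∑ N (up j)) ⊕ ∑ N (λ j → ∑ N (wb j))
      ≈⟨ ∑-⊕ N _ _ ⟨
    ∑ N (λ j → (∑ N (lo j) ⊕ ∑ N (eq j) ⊕ ∑ N (up j)) ⊕ ∑ N (wb j))
      ≈⟨ ∑-cong N (λ j → ≈-trans (⊕-cong (≈-trans (⊕-cong (≈-sym (∑-⊕ N _ _)) ≈-refl) (≈-sym (∑-⊕ N _ _))) ≈-refl)
           (≈-sym (∑-⊕ N _ _))) ⟩
    ∑ N (λ j → ∑ N λ k → lo j k ⊕ eq j k ⊕ up j k ⊕ wb j k)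
      ≈⟨ ∑-cong N (λ j → ∑-cong N λ k → key (suc j) k) ⟩
    ∑ N (λ j → ∑ N λ k → dq (sh (k * (a + j)) (r j)) ⊕ ib j k)
      ≈⟨ ≈-trans (∑-swap N N _) (≈-trans (∑-cong N λ k → ∑-⊕ N _ _) (∑-⊕ N _ _)) ⟩
    ∑ N (λ k → ∑ N λ j → dq (sh (k * (a + j)) (r j))) ⊕ ∑ N (λ k → ∑ N λ j → ib j k)
      ≈⟨ ⊕-cong (≈-trans (dq-∑ N _) (∑-cong N λ k → dq-∑ N _))
           (∑-cong N λ k → ∑-cong N λ j → sh-≈ (suc k * (a + suc j)) (R-⊕ (suc l)
             (λ ys → val (a + suc j) ✖ W ((suc j + head ys) ∷ tail ys)) (insertV l (a + suc j) (W ∘ (suc j ∷_))) (a + suc j))) ⟨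
    dq (R (suc l) W a) ⊕ R (suc (suc l)) (insertV (suc l) a W) a ∎
    where
      r C U : ℕ → Series
      r j = R l (W ∘ (j ∷_)) (a + j)
      C j = ∑ N λ m → sh (m * (a + j)) (r j)
      U j = R (suc l) (λ ys → W ((j + head ys) ∷ tail ys)) (a + j)

      -- Here j is a first coordinate and k the multiplicity of a + j. `lo`, `eq` and `up` are the
      -- cases V > V_1, V = V_1 and V < V_1; `wb` and `ib` come from `partialSums` and `insertV`.
      lo eq up wb ib : ℕ → ℕ → Series
      lo j k = sh (k * (a + j)) (Q (a + j) (r j))
      eq j k = ∑ (k ∸ 1) λ _ → val (a + j) · sh (k * (a + j)) (r j)
      up j k = val (a + j) · sh (k * (a + j)) (U j)
      wb j k = sh (k * (a + j)) (R l (λ vs → val (a + j) ✖ W (j ∷ vs) ✚ partialSums l (a + j) (W ∘ (j ∷_)) vs) (a + j))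
      ib j k = sh (k * (a + j)) (R (suc l) (λ ys → val (a + j) ✖ W ((j + head ys) ∷ tail ys)) (a + j)
        ⊕ R (suc l) (insertV l (a + j) (W ∘ (j ∷_))) (a + j))

      lower : ∀ j → ∑ N (λ z → Q₁ (a + (j + z)) (C j)) ≈ ∑ N (lo j)
      lower j = begin
        ∑ N (λ z → Q₁ (a + (j + z)) (C j))
          ≈⟨ ∑-cong N (λ z → exact λ n → cong (λ w → Q₁ w (C j) n) (ℕₚ.+-assoc a j (suc z))) ⟨
        Q (a + j) (C j)
          ≈⟨ ∑-hom (Q-linear (a + j)) N _ ⟩
        ∑ N (λ k → Q (a + j) (sh (k * (a + j)) (r j)))
          ≈⟨ ∑-cong N (λ k → sh-hom (Q-linear (a + j)) (suc k * (a + j)) (r j)) ⟩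
        ∑ N (lo j) ∎

      same : ∀ j → Q₁ (a + suc j) (C (suc j)) ≈ ∑ N (eq (suc j))
      same j = begin
        Q₁ w (C (suc j))
          ≈⟨ ∑-hom (Q₁-linear w) N _ ⟩
        ∑ N (λ i → ∑ N λ m → val w · sh (m * w) (sh (i * w) (r (suc j))))
          ≈⟨ ∑-cong N (λ i → ∑-cong N λ m → ·-cong (val w) (exact (combine (suc i) (suc m)))) ⟩
        ∑ N (λ i → ∑ N λ m → G i (i + m))
          -- `G` ignores its first argument, so for each k = i + m there remain k - 1 equal terms.
          ≈⟨ reindex G (λ i k N<k → ≈-trans (·-cong (val w) (sh-vanish (r (suc j)) (ℕₚ.<-≤-trans N<k (k≤k*w k))))
               (exact λ _ → ℚₚ.*-zeroʳ (val w))) ⟨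
        ∑ N (eq (suc j)) ∎
        where
          w = a + suc j

          k≤k*w : ∀ k → k ≤ k * w
          k≤k*w k rewrite ℕₚ.+-suc a j = ℕₚ.m≤m*n k (suc (a + j))

          G : ℕ → ℕ → Series
          G _ k = val w · sh (k * w) (r (suc j))

          combine : ∀ i m n → sh (m * w) (sh (i * w) (r (suc j))) n ≡ sh ((i + m) * w) (r (suc j)) n
          combine i m n = trans (sym (sh-+ (m * w) (i * w) (r (suc j)) n))
            (cong (λ k → sh k (r (suc j)) n) (trans (ℕₚ.+-comm (m * w) (i * w)) (sym (ℕₚ.*-distribʳ-+ w i m))))

      -- The old first coordinate j + z is cut at the new V = a + j: now j comes first and z second,
      -- and W is evaluated at their sum.
      upper : ∀ j → ∑ N (λ z → Q₁ (a + j) (C (j + z))) ≈ ∑ N (up j)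
      upper j = begin
        ∑ N (λ z → Q₁ (a + j) (C (j + z)))
          ≈⟨ ∑-hom (Q₁-linear (a + j)) N _ ⟨
        Q₁ (a + j) (∑ N λ z → C (j + z))
          ≈⟨ ≈-cong (Q₁-linear (a + j)) (begin
               ∑ N (λ z → C (j + z))
                 ≈⟨ ∑-cong N (λ z → ∑-cong N λ m → exact λ n →
                      cong (λ w → sh (suc m * w) (R l (W ∘ ((j + suc z) ∷_)) w) n) (ℕₚ.+-assoc a j (suc z))) ⟨
               ∑ N (λ z → ∑ N λ m → sh (m * (a + j + z)) (R l (W ∘ ((j + z) ∷_)) (a + j + z)))
                 ≈⟨ ∑-swap N N _ ⟩
               U j ∎) ⟩
        ∑ N (up j) ∎

      lhs : Q a (R (suc l) W a) ≈ ∑ N (λ j → ∑ N (lo j) ⊕ ∑ N (eq j) ⊕ ∑ N (up j))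
      lhs = begin
        Q a (R (suc l) W a)
          -- The comparison concerns V_1 = a + v_1, so the sum over v_1 is moved outside the sum
          -- over m_1.
          ≈⟨ ≈-cong (Q-linear a) (∑-swap N N _) ⟩
        Q a (∑ N C)
          ≈⟨ ∑-cong N (λ x → ∑-hom (Q₁-linear (a + suc x)) N C) ⟩
        ∑ N (λ x → ∑ N λ y → Q₁ (a + x) (C y))
          ≈⟨ triangle N (λ x y → Q₁ (a + x) (C y)) ⟩
        ∑ N (λ i → ∑ (i ∸ 1) (λ j → Q₁ (a + i) (C j)) ⊕ Q₁ (a + i) (C i) ⊕ ∑ (i ∸ 1) (λ j → Q₁ (a + j) (C i)))
          ≈⟨ ≈-trans (∑-⊕ N _ _) (⊕-cong (∑-⊕ N _ _) ≈-refl) ⟩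
        ∑ N (λ i → ∑ (i ∸ 1) λ j → Q₁ (a + i) (C j)) ⊕ ∑ N (λ i → Q₁ (a + i) (C i)) ⊕ ∑ N (λ i → ∑ (i ∸ 1) λ j → Q₁ (a + j) (C i))
          ≈⟨ ⊕-cong (⊕-cong
               (≈-trans (reindex (λ j i → Q₁ (a + i) (C j)) λ j k N<k → Q₁-vanish (C (suc j)) (ℕₚ.<-≤-trans N<k (ℕₚ.m≤n+m k a)))
                 (∑-cong N λ j → lower (suc j)))
               (∑-cong N same))
               (≈-trans (reindex (λ j i → Q₁ (a + j) (C i)) λ j k N<k → C-vanish (suc j) k N<k)
                 (∑-cong N λ j → upper (suc j))) ⟩
        ∑ N (λ j → ∑ N (lo j)) ⊕ ∑ N (λ j → ∑ N (eq j)) ⊕ ∑ N (λ j → ∑ N (up j))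
          ≈⟨ ≈-trans (∑-⊕ N _ _) (⊕-cong (∑-⊕ N _ _) ≈-refl) ⟨
        ∑ N (λ j → ∑ N (lo j) ⊕ ∑ N (eq j) ⊕ ∑ N (up j)) ∎
        where
          C-vanish : ∀ j k → N < k → Q₁ (a + j) (C k) ≈ λ _ → 0ℚ
          C-vanish j k N<k = ≈-trans (≈-cong (Q₁-linear (a + j)) (∑-vanish N λ m →
              sh-vanish (r k) (ℕₚ.<-≤-trans N<k (ℕₚ.≤-trans (ℕₚ.m≤n+m k a) (ℕₚ.m≤n*m (a + k) (suc m))))))
            (∑-hom (Q₁-linear (a + j)) 0 (λ _ _ → 0ℚ))

      key : ∀ j k → lo j (suc k) ⊕ eq j (suc k) ⊕ up j (suc k) ⊕ wb j (suc k) ≈ dq (sh (suc k * (a + j)) (r j)) ⊕ ib j (suc k)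
      key j k = begin
        L ⊕ E ⊕ Up ⊕ wb j (suc k)
          ≈⟨ ⊕-cong (≈-refl {L ⊕ E ⊕ Up}) (≈-trans (sh-≈ K (≈-trans
               (R-⊕ l (λ vs → q ✖ W (j ∷ vs)) (partialSums l w (W ∘ (j ∷_))) w) (⊕-cong (R-· l q (W ∘ (j ∷_)) w) ≈-refl)))
               (≈-trans (exact (sh-⊕ K _ _)) (⊕-cong (exact (sh-· K q _)) ≈-refl))) ⟩
        L ⊕ E ⊕ Up ⊕ (q · X ⊕ M)
          ≈⟨ exact (λ n → solve 5 (λ l e u x m → l :+ e :+ u :+ (x :+ m) := e :+ x :+ u :+ (l :+ m)) refl
               (L n) (E n) (Up n) (q ✖ X n) (M n)) ⟩
        E ⊕ q · X ⊕ Up ⊕ (L ⊕ M)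
          -- `count` completes the splittings in `E` to the factor K = m_1 V_1. The induction
          -- hypothesis, multiplied by q^K, rewrites `L ⊕ M`.
          ≈⟨ ⊕-cong (⊕-cong (exact count) (≈-refl {Up}))
               (≈-trans (≈-sym (exact (sh-⊕ K _ _))) (≈-trans (sh-≈ K (V-expansion l w (W ∘ (j ∷_)))) (exact (sh-⊕ K _ _)))) ⟩
        val K · X ⊕ Up ⊕ (sh K (dq (r j)) ⊕ sh K I)
          ≈⟨ ⊕-interchange (val K · X) Up (sh K (dq (r j))) (sh K I) ⟩
        val K · X ⊕ sh K (dq (r j)) ⊕ (Up ⊕ sh K I)
          ≈⟨ ⊕-cong (exact (dq-sh K (r j))) (≈-trans (exact (sh-⊕ K _ _)) (⊕-cong
               (≈-trans (sh-≈ K (R-· (suc l) q (λ ys → W ((j + head ys) ∷ tail ys)) w)) (exact (sh-· K q _))) ≈-refl)) ⟨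
        dq X ⊕ ib j (suc k) ∎
        where
          open +-*-Solver
          w = a + j
          K = suc k * w
          q = val w
          L E Up X M I : Series
          L = lo j (suc k)
          E = eq j (suc k)
          Up = up j (suc k)
          X = sh K (r j)
          M = sh K (R l (partialSums l w (W ∘ (j ∷_))) w)
          I = R (suc l) (insertV l w (W ∘ (j ∷_))) w

          count : ∀ n → (E ⊕ q · X) n ≡ (val K · X) n
          count n = trans (sym (val-suc-* k (q ✖ X n)))
            (trans (sym (ℚₚ.*-assoc (val (suc k)) q (X n))) (cong (_✖ X n) (sym (val-* (suc k) w))))

  -- Comparison of the two expansions, and coefficients of brackets.

  -- Up to q^N, `Q 0` and `P N` are the same multiplication by [2], with the order of its two
  -- summations exchanged, and conjugation identifies `R` with `S`. Hence both expansions compute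
  -- one product.
  dq-S : ∀ l W → dq (S l W N) ⊕ S (suc l) (insertV l 0 W) N ≈ S (suc l) (insertU l W) N ⊕ S l (splitV l W) N ⊕ S l (partialSums l 0 W) N
  dq-S l W = begin
    dq (S l W N) ⊕ S (suc l) (insertV l 0 W) N
      ≈⟨ ⊕-cong (dq-cong (R≈S l W)) (R≈S (suc l) (insertV l 0 W)) ⟨
    dq (R l W 0) ⊕ R (suc l) (insertV l 0 W) 0
      ≈⟨ V-expansion l 0 W ⟨
    Q 0 (R l W 0) ⊕ R l (partialSums l 0 W) 0
      ≈⟨ ⊕-cong (≈-trans (Linear.≈-cong (Q-linear 0) (R≈S l W)) (≈-trans (∑-swap N N _) (u-expansion l W N))) (R≈S l (partialSums l 0 W)) ⟩
    S (suc l) (insertU l W) N ⊕ S l (splitV l W) N ⊕ S l (partialSums l 0 W) N ∎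

  S-mono : ∀ {l} (rs : Vec ℕ l) b n → n ≤ N → S l (mono rs) b n ≡ val (sig (Vec.toList rs) n b)
  S-mono []       b zero    _   = refl
  S-mono []       b (suc n) _   = refl
  S-mono {suc l} (r ∷ rs) b n n≤N = trans (sum-cong b row) (sym (val-sumFrom1 b _))
    where
      term : ℕ → ℕ → ℚ
      term u v = sh (suc u * v) (S l (λ vs → val (v ^ r) ✖ mono rs vs) u) n

      row : ∀ u → sum N (term u)
        ≡ val (sumFrom1 n λ v → if (suc u * v) ≤ᵇ n then v ^ r * sig (Vec.toList rs) (n ∸ suc u * v) u else 0)
      row u = trans (cong (λ c → sum c (term u)) (sym (ℕₚ.m+[n∸m]≡n n≤N)))
        -- `sig` bounds v by n, whereas `S` bounds it by N. A term with v > n has exponent u v > n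
        -- and does not contribute.
        (trans (sum-extend n (N ∸ n) (term u) λ v n<v → sh-< (suc u * v) _ (ℕₚ.<-≤-trans n<v (ℕₚ.m≤n*m v (suc u))))
        (trans (sum-cong n λ v → sh-if (suc u * suc v) n _ (λ m → suc v ^ r * sig (Vec.toList rs) m u) λ m m≤n →
            trans (at (S-· l (val (suc v ^ r)) (mono rs) u) m (ℕₚ.≤-trans m≤n n≤N))
              (trans (cong (val (suc v ^ r) ✖_) (S-mono rs u m (ℕₚ.≤-trans m≤n n≤N))) (sym (val-* (suc v ^ r) _))))
          (sym (val-sumFrom1 n _))))

-- Reciprocals, and polynomials in one variable.

-1ℚ : ℚ
-1ℚ = ℚ.- 1ℚ

recip : ∀ d .{{_ : NonZero d}} → ℚ
recip d = ℤ.+ 1 ℚ./ d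

/-val : ∀ m d .{{_ : NonZero d}} → ℤ.+ m ℚ./ d ≡ recip d ✖ val m
/-val m (suc d) = ℚₚ.toℚᵘ-injective (begin
  ℚ.toℚᵘ (ℤ.+ m ℚ./ suc d)                            ≈⟨ ℚₚ.toℚᵘ-fromℚᵘ (ℚᵘ.mkℚᵘ (ℤ.+ m) d) ⟩
  ℚᵘ.mkℚᵘ (ℤ.+ m) d
    ≈⟨ ℚᵘ.*≡* (cong₂ ℤ._*_ (sym (ℤₚ.*-identityˡ (ℤ.+ m))) (cong (λ k → ℤ.+ suc k) (ℕₚ.*-identityʳ d))) ⟩
  ℚᵘ.mkℚᵘ (ℤ.+ 1) d ℚᵘ.* ℚᵘ.mkℚᵘ (ℤ.+ m) 0              ≈⟨ ℚᵘₚ.*-cong (ℚₚ.toℚᵘ-fromℚᵘ (ℚᵘ.mkℚᵘ (ℤ.+ 1) d)) (val-≃ m) ⟨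
  ℚ.toℚᵘ (recip (suc d)) ℚᵘ.* ℚ.toℚᵘ (val m)        ≈⟨ ℚₚ.toℚᵘ-homo-* (recip (suc d)) (val m) ⟨
  ℚ.toℚᵘ (recip (suc d) ✖ val m)                  ∎)
  where open ℚᵘₚ.≃-Reasoning

1/-val : ∀ d .{{_ : NonZero d}} → recip d ✖ val d ≡ 1ℚ
1/-val (suc d) = trans (sym (/-val (suc d) (suc d))) (ℚₚ.toℚᵘ-injective
  (ℚᵘₚ.≃-trans (ℚₚ.toℚᵘ-fromℚᵘ (ℚᵘ.mkℚᵘ (ℤ.+ suc d) d)) (ℚᵘ.*≡* (ℤₚ.*-comm (ℤ.+ suc d) (ℤ.+ 1)))))

-- Rising factorials rather than powers, because Σ_{1 ≤ i ≤ x} rise j i = rise (j + 1) x / (j + 1).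
rise : ℕ → ℕ → ℚ
rise zero    x = 1ℚ
rise (suc j) x = rise j x ✖ (val x ✚ val j)

-- Both sides are the product x (x + 1) ... (x + j).
rise-shift : ∀ j x → rise j (suc x) ✖ val x ≡ rise j x ✖ (val x ✚ val j)
rise-shift zero    x = cong (1ℚ ✖_) (sym (ℚₚ.+-identityʳ (val x)))
rise-shift (suc j) x = begin
  rise j (suc x) ✖ (val (suc x) ✚ val j) ✖ val x    ≡⟨ cong (λ z → rise j (suc x) ✖ (z ✚ val j) ✖ val x) (val-+ 1 x) ⟩
  rise j (suc x) ✖ (1ℚ ✚ val x ✚ val j) ✖ val x
    ≡⟨ solve 3 (λ r x j → r :* (con 1ℚ :+ x :+ j) :* x := r :* x :* (x :+ (con 1ℚ :+ j))) refl (rise j (suc x)) (val x) (val j) ⟩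
  rise j (suc x) ✖ val x ✖ (val x ✚ (1ℚ ✚ val j))   ≡⟨ cong₂ (λ p q → p ✖ (val x ✚ q)) (rise-shift j x) (sym (val-+ 1 j)) ⟩
  rise (suc j) x ✖ (val x ✚ val (suc j))            ∎
  where
    open ≡-Reasoning
    open +-*-Solver

-- Telescoping: by `rise-shift`, the increment of `rise (suc j)` from x to x + 1 is (j + 1) times
-- `rise j (suc x)`.
sum-rise : ∀ j x → val (suc j) ✖ sum x (rise j) ≡ rise (suc j) x
sum-rise zero    zero    = refl
-- At x = 0 the rising factorial contains the factor 0, which the recursion on j exposes.
sum-rise (suc j) zero    = trans (ℚₚ.*-zeroʳ (val (suc (suc j)))) (sym (trans (cong (_✖ (0ℚ ✚ val (suc j))) (sym (sum-rise j zero)))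
  (trans (cong (_✖ (0ℚ ✚ val (suc j))) (ℚₚ.*-zeroʳ (val (suc j)))) (ℚₚ.*-zeroˡ (0ℚ ✚ val (suc j))))))
sum-rise j (suc x) = begin
  val (suc j) ✖ (sum x (rise j) ✚ r)                ≡⟨ ℚₚ.*-distribˡ-+ (val (suc j)) (sum x (rise j)) r ⟩
  val (suc j) ✖ sum x (rise j) ✚ val (suc j) ✖ r
    ≡⟨ cong₂ _✚_ (trans (sum-rise j x) (sym (rise-shift j x))) (cong (_✖ r) (val-+ 1 j)) ⟩
  r ✖ val x ✚ (1ℚ ✚ val j) ✖ r
    ≡⟨ solve 3 (λ r x j → r :* x :+ (con 1ℚ :+ j) :* r := r :* (con 1ℚ :+ x :+ j)) refl r (val x) (val j) ⟩
  r ✖ (1ℚ ✚ val x ✚ val j)                          ≡⟨ cong (λ z → r ✖ (z ✚ val j)) (val-+ 1 x) ⟨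
  rise (suc j) (suc x)                              ∎
  where
    open ≡-Reasoning
    open +-*-Solver
    r = rise j (suc x)

-- Polynomials of degree at most k, in the basis of rising factorials. The constructor `ext` closes
-- the class under pointwise equality, in place of function extensionality.
data Rising : ℕ → (ℕ → ℚ) → Set where
  base : ∀ c {j k} → j ≤ k → Rising k (λ x → c ✖ rise j x)
  add  : ∀ {k f g} → Rising k f → Rising k g → Rising k (λ x → f x ✚ g x)
  ext  : ∀ {k f g} → (∀ x → f x ≡ g x) → Rising k f → Rising k g

-- In the basis: x times `rise j x` is `rise (suc j) x` minus j times `rise j x`.
Rising-x : ∀ {k f} → Rising k f → Rising (suc k) (λ x → val x ✖ f x)
Rising-x (base c {j} j≤k) = ext
  (λ x → solve 4 (λ c r x j → c :* (r :* (x :+ j)) :+ (:- (c :* j)) :* r := x :* (c :* r)) refl c (rise j x) (val x) (val j))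
  (add (base c (s≤s j≤k)) (base (ℚ.- (c ✖ val j)) (ℕₚ.m≤n⇒m≤1+n j≤k)))
  where open +-*-Solver
Rising-x (add {f = f} {g} p q) = ext (λ x → sym (ℚₚ.*-distribˡ-+ (val x) (f x) (g x))) (add (Rising-x p) (Rising-x q))
Rising-x (ext e p) = ext (λ x → cong (val x ✖_) (e x)) (Rising-x p)

Rising-^ : ∀ r → Rising r (λ x → val (x ^ r))
Rising-^ zero    = ext (λ _ → refl) (base 1ℚ {0} z≤n)
Rising-^ (suc r) = ext (λ x → sym (val-* x (x ^ r))) (Rising-x (Rising-^ r))

Rising-sum : ∀ {k f} → Rising k f → Rising (suc k) (λ x → sum x f)
Rising-sum (base c {j} j≤k) = ext (λ x → begin
    c ✖ recip (suc j) ✖ rise (suc j) x                       ≡⟨ cong (c ✖ recip (suc j) ✖_) (sum-rise j x) ⟨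
    c ✖ recip (suc j) ✖ (val (suc j) ✖ sum x (rise j))
      ≡⟨ solve 4 (λ c i v s → c :* i :* (v :* s) := c :* (i :* v :* s)) refl c (recip (suc j)) (val (suc j)) (sum x (rise j)) ⟩
    c ✖ (recip (suc j) ✖ val (suc j) ✖ sum x (rise j))       ≡⟨ cong (λ z → c ✖ (z ✖ sum x (rise j))) (1/-val (suc j)) ⟩
    c ✖ (1ℚ ✖ sum x (rise j))                                  ≡⟨ cong (c ✖_) (ℚₚ.*-identityˡ (sum x (rise j))) ⟩
    c ✖ sum x (rise j)                                         ≡⟨ sum-* x c (rise j) ⟨
    sum x (λ y → c ✖ rise j y)                                 ∎)
  (base (c ✖ recip (suc j)) (s≤s j≤k))
  where
    open ≡-Reasoning
    open +-*-Solver
Rising-sum (add {f = f} {g} p q) = ext (λ x → sym (sum-+ x f g)) (add (Rising-sum p) (Rising-sum q))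
Rising-sum (ext e p) = ext (λ x → sum-cong x (λ i → e (suc i))) (Rising-sum p)

-- Polynomial weights

data Poly (l : ℕ) : ℕ → Weight l → Set where
  const : ∀ {k} c → Poly l k (λ _ → c)
  var   : ∀ {k f} i → Poly l k f → Poly l (suc k) (λ v → val (lookup v i) ✖ f v)
  add   : ∀ {k f g} → Poly l k f → Poly l k g → Poly l k (λ v → f v ✚ g v)
  ext   : ∀ {k f g} → (∀ v → f v ≡ g v) → Poly l k f → Poly l k g

module _ {l : ℕ} where

  weaken : ∀ {j k f} → j ≤ k → Poly l j f → Poly l k f
  weaken j≤k       (const c) = const c
  weaken (s≤s j≤k) (var i p) = var i (weaken j≤k p)
  weaken j≤k       (add p q) = add (weaken j≤k p) (weaken j≤k q)
  weaken j≤k       (ext e p) = ext e (weaken j≤k p)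

  scale : ∀ {k f} c → Poly l k f → Poly l k (λ v → c ✖ f v)
  scale c (const d) = const (c ✖ d)
  scale c (var {f = f} i p) = ext (λ v → solve 3 (λ x c y → x :* (c :* y) := c :* (x :* y)) refl (val (lookup v i)) c (f v)) (var i (scale c p))
    where open +-*-Solver
  scale c (add {f = f} {g} p q) = ext (λ v → sym (ℚₚ.*-distribˡ-+ c (f v) (g v))) (add (scale c p) (scale c q))
  scale c (ext e p) = ext (λ v → cong (c ✖_) (e v)) (scale c p)

  mul : ∀ {j k f g} → Poly l j f → Poly l k g → Poly l (j + k) (λ v → f v ✖ g v)
  mul {j} {k} (const c) q = weaken (ℕₚ.m≤n+m k j) (scale c q)
  mul {g = g} (var {f = f} i p) q = ext (λ v → sym (ℚₚ.*-assoc (val (lookup v i)) (f v) (g v))) (var i (mul p q))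
  mul {g = h} (add {f = f} {g} p p′) q = ext (λ v → sym (ℚₚ.*-distribʳ-+ (h v) (f v) (g v))) (add (mul p q) (mul p′ q))
  mul {g = g} (ext e p) q = ext (λ v → cong (_✖ g v) (e v)) (mul p q)

  -- Only variables, zero and sums of these are substituted for coordinates. As they have degree at
  -- most 1, the substitution keeps every degree bound.
  record Affine (x : Vec ℕ l → ℕ) : Set where
    constructor affine
    field poly : Poly l 1 (val ∘ x)
  open Affine

  affine-+ : ∀ {x y} → Affine x → Affine y → Affine (λ e → x e + y e)
  affine-+ {x} {y} p q = affine (ext (λ e → sym (val-+ (x e) (y e))) (add (poly p) (poly q)))

  affine-^ : ∀ {x} r → Affine x → Poly l r (λ e → val (x e ^ r))
  affine-^     zero    p = const 1ℚ
  affine-^ {x} (suc r) p = ext (λ e → sym (val-* (x e) (x e ^ r))) (mul (poly p) (affine-^ r p))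

  affine-rise : ∀ {x} j → Affine x → Poly l j (rise j ∘ x)
  affine-rise zero    p = const 1ℚ
  affine-rise (suc j) p = weaken (ℕₚ.≤-reflexive (ℕₚ.+-comm j 1)) (mul (affine-rise j p) (add (poly p) (const (val j))))

  affine-Rising : ∀ {k f x} → Rising k f → Affine x → Poly l k (f ∘ x)
  affine-Rising     (base c j≤k) p = weaken j≤k (scale c (affine-rise _ p))
  affine-Rising     (add q q′)   p = add (affine-Rising q p) (affine-Rising q′ p)
  affine-Rising {x = x} (ext e q) p = ext (λ v → e (x v)) (affine-Rising q p)

  evalAt : ∀ {m} → Vec (Vec ℕ l → ℕ) m → Vec ℕ l → Vec ℕ m
  evalAt xs e = Vec.map (λ x → x e) xs

  -- The weight itself depends on the environment, so that its first coordinate can be fixed in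
  -- the recursions of insertU, partialSums and insertV.
  PolyFamily : ℕ → ∀ {m} → (Vec ℕ l → Weight m) → Set
  PolyFamily k W = ∀ xs → VecAll.All Affine xs → Poly l k (λ e → W e (evalAt xs e))

  insertU-poly : ∀ m {k} (W : Vec ℕ l → Weight m) → PolyFamily k W → PolyFamily (suc k) (λ e → insertU m (W e))
  insertU-poly zero    W p (x ∷ xs) (q ∷ qs) = mul (poly q) (p xs qs)
  insertU-poly (suc m) W p (x ∷ xs) (q ∷ qs) = add (mul (poly q) (p xs qs))
    (insertU-poly m (λ e vs → W e (x e ∷ vs)) (λ ys r → p (x ∷ ys) (q ∷ r)) xs qs)

  partialSums-poly : ∀ m {k} {a} (W : Vec ℕ l → Weight m) → Affine a → PolyFamily k W → PolyFamily (suc k) (λ e → partialSums m (a e) (W e))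
  partialSums-poly zero    W α p xs       qs       = const 0ℚ
  partialSums-poly (suc m) W α p (x ∷ xs) (q ∷ qs) = add (mul (poly (affine-+ α q)) (p (x ∷ xs) (q ∷ qs)))
    (partialSums-poly m (λ e vs → W e (x e ∷ vs)) (affine-+ α q) (λ ys r → p (x ∷ ys) (q ∷ r)) xs qs)

  -- The merged coordinate x + y is again affine, so the degree rises only through the one factor a
  -- + x.
  insertV-poly : ∀ m {k} {a} (W : Vec ℕ l → Weight m) → Affine a → PolyFamily k W → PolyFamily (suc k) (λ e → insertV m (a e) (W e))
  insertV-poly zero    W α p (x ∷ xs)     (q ∷ qs)      = mul (poly (affine-+ α q)) (p xs qs)
  insertV-poly (suc m) W α p (x ∷ y ∷ xs) (q ∷ q′ ∷ qs) = add (mul (poly (affine-+ α q)) (p _ (affine-+ q q′ ∷ qs)))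
    (insertV-poly m (λ e vs → W e (x e ∷ vs)) (affine-+ α q) (λ ys r → p (x ∷ ys) (q ∷ r)) (y ∷ xs) (q′ ∷ qs))

-- Monomial weights and the splitting of a coordinate.

mono-poly : ∀ {l m} (rs : Vec ℕ m) → PolyFamily {l} (Vec.sum rs) (λ _ → mono rs)
mono-poly []       []       []       = const 1ℚ
mono-poly (r ∷ rs) (x ∷ xs) (q ∷ qs) = mul (affine-^ r q) (mono-poly rs xs qs)

-- Fixing the first coordinate of a monomial leaves a scalar multiple of a monomial; this takes the
-- scalar out in the recursion of `splitV`.
splitV-scale : ∀ m c (W : Weight m) v → splitV m (λ vs → c ✖ W vs) v ≡ c ✖ splitV m W v
splitV-scale zero    c W _        = sym (ℚₚ.*-zeroʳ c)
splitV-scale (suc m) c W (x ∷ vs) = begin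
  sum (x ∸ 1) (λ v → val v ✖ (c ✖ W ((x ∸ v) ∷ vs))) ✚ splitV m (λ ws → c ✖ W (x ∷ ws)) vs
    ≡⟨ cong₂ _✚_ (trans (sum-cong (x ∸ 1) λ v → solve 3 (λ a b w → a :* (b :* w) := b :* (a :* w)) refl (val (suc v)) c (W ((x ∸ suc v) ∷ vs)))
         (sum-* (x ∸ 1) c (λ v → val v ✖ W ((x ∸ v) ∷ vs)))) (splitV-scale m c (W ∘ (x ∷_)) vs) ⟩
  c ✖ sum (x ∸ 1) (λ v → val v ✖ W ((x ∸ v) ∷ vs)) ✚ c ✖ splitV m (W ∘ (x ∷_)) vs
    ≡⟨ ℚₚ.*-distribˡ-+ c (sum (x ∸ 1) (λ v → val v ✖ W ((x ∸ v) ∷ vs))) (splitV m (W ∘ (x ∷_)) vs) ⟨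
  c ✖ splitV (suc m) W (x ∷ vs) ∎
  where
    open ≡-Reasoning
    open +-*-Solver

sum-suc : ∀ b f → sum (suc b) f ≡ f 1 ✚ sum b (f ∘ suc)
sum-suc b f = trans (sum-split 1 b f) (cong (_✚ sum b (f ∘ suc)) (ℚₚ.+-identityˡ (f 1)))

sum-reverse : ∀ x h → sum x (λ v → h (suc x ∸ v)) ≡ sum x h
sum-reverse zero    h = refl
sum-reverse (suc x) h = begin
  sum (suc x) (λ v → h (suc (suc x) ∸ v))      ≡⟨ sum-suc x (λ v → h (suc (suc x) ∸ v)) ⟩
  h (suc x) ✚ sum x (λ v → h (suc x ∸ v))      ≡⟨ cong (h (suc x) ✚_) (sum-reverse x h) ⟩
  h (suc x) ✚ sum x h                          ≡⟨ ℚₚ.+-comm (h (suc x)) (sum x h) ⟩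
  sum (suc x) h                                ∎
  where open ≡-Reasoning

-- On either side h(i) is counted x + 1 - i times. The convolution thus becomes an iterated sum, to
-- which `Rising-sum` applies.
sum-convolve : ∀ x h → sum x (λ v → val v ✖ h (suc x ∸ v)) ≡ sum x (λ y → sum y h)
sum-convolve zero    h = refl
sum-convolve (suc x) h = begin
  sum (suc x) (λ v → val v ✖ h (suc (suc x) ∸ v))
    ≡⟨ sum-suc x (λ v → val v ✖ h (suc (suc x) ∸ v)) ⟩
  1ℚ ✖ h (suc x) ✚ sum x (λ v → val (suc v) ✖ h (suc x ∸ v))
    ≡⟨ cong₂ _✚_ (ℚₚ.*-identityˡ (h (suc x))) (trans (sum-cong x λ v → trans (cong (_✖ h (suc x ∸ suc v)) (val-+ 1 (suc v)))
         (solve 2 (λ v y → (con 1ℚ :+ v) :* y := y :+ v :* y) refl (val (suc v)) (h (suc x ∸ suc v))))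
         (sum-+ x (λ v → h (suc x ∸ v)) (λ v → val v ✖ h (suc x ∸ v)))) ⟩
  h (suc x) ✚ (sum x (λ v → h (suc x ∸ v)) ✚ sum x (λ v → val v ✖ h (suc x ∸ v)))
    ≡⟨ cong₂ (λ p q → h (suc x) ✚ (p ✚ q)) (sum-reverse x h) (sum-convolve x h) ⟩
  h (suc x) ✚ (sum x h ✚ sum x (λ y → sum y h))
    ≡⟨ solve 3 (λ a b c → a :+ (b :+ c) := c :+ (b :+ a)) refl (h (suc x)) (sum x h) (sum x (λ y → sum y h)) ⟩
  sum (suc x) (λ y → sum y h) ∎
  where
    open ≡-Reasoning
    open +-*-Solver

convolve : ℕ → ℕ → ℚ
convolve r x = sum (x ∸ 1) (λ v → val v ✖ val ((x ∸ v) ^ r))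

-- By `sum-convolve` this is the sum of the power sums `G y` over y < x, written as the sum over y ≤
-- x minus `G x`. Each of the two summations raises the degree by one.
Rising-convolve : ∀ r → Rising (2 + r) (convolve r)
Rising-convolve r = ext eq (add (Rising-sum G-rising) (minus G-rising))
  where
    G : ℕ → ℚ
    G y = sum y (λ w → val (w ^ r))

    G-rising : Rising (suc r) G
    G-rising = Rising-sum (Rising-^ r)

    minus : ∀ {k f} → Rising k f → Rising (suc k) (λ x → ℚ.- f x)
    minus (base c {j} j≤k) = ext (λ x → sym (ℚₚ.neg-distribˡ-* c (rise j x))) (base (ℚ.- c) (ℕₚ.m≤n⇒m≤1+n j≤k))
    minus (add {f = f} {g} p q) = ext (λ x → sym (ℚₚ.neg-distrib-+ (f x) (g x))) (add (minus p) (minus q))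
    minus (ext e p) = ext (λ x → cong ℚ.-_ (e x)) (minus p)

    eq : ∀ x → sum x G ✚ (ℚ.- G x) ≡ convolve r x
    eq zero    = refl
    eq (suc x) = trans (ℚₚ.+-assoc (sum x G) (G (suc x)) (ℚ.- G (suc x)))
      (trans (cong (sum x G ✚_) (ℚₚ.+-inverseʳ (G (suc x)))) (trans (ℚₚ.+-identityʳ (sum x G)) (sym (sum-convolve x (λ w → val (w ^ r))))))

-- For a monomial, the sum over the splittings of one coordinate involves that coordinate alone and
-- factors as `convolve r` times the remaining monomial.
splitV-poly : ∀ {l m} (rs : Vec ℕ m) → PolyFamily {l} (2 + Vec.sum rs) (λ _ → splitV m (mono rs))
splitV-poly []       xs       qs       = const 0ℚ
splitV-poly {l} {suc m} (r ∷ rs) (x ∷ xs) (q ∷ qs) = ext eq (add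
    (mul (affine-Rising (Rising-convolve r) q) (mono-poly rs xs qs))
    (weaken (ℕₚ.≤-reflexive (trans (ℕₚ.+-suc r (suc (Vec.sum rs))) (cong suc (ℕₚ.+-suc r (Vec.sum rs))))) (mul (affine-^ r q) (splitV-poly rs xs qs))))
  where
    open +-*-Solver
    eq : ∀ e → convolve r (x e) ✖ mono rs (evalAt xs e) ✚ val (x e ^ r) ✖ splitV m (mono rs) (evalAt xs e)
      ≡ splitV (suc m) (mono (r ∷ rs)) (x e ∷ evalAt xs e)
    eq e = cong₂ _✚_
      (trans (ℚₚ.*-comm (convolve r (x e)) M) (trans (sym (sum-* (x e ∸ 1) M (λ v → val v ✖ val ((x e ∸ v) ^ r))))
        (sum-cong (x e ∸ 1) λ v → solve 3 (λ a b c → c :* (a :* b) := a :* (b :* c)) refl (val (suc v)) (val ((x e ∸ suc v) ^ r)) M)))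
      (sym (splitV-scale m (val (x e ^ r)) (mono rs) (evalAt xs e)))
      where M = mono rs (evalAt xs e)

-- Nested sums without truncation.

-- Truncation at N = n does not affect the coefficient of q^n, so this is the whole series S(W).
series : ∀ l → Weight l → Series
series l W n = Truncated.S n l W n n

module _ {l : ℕ} where

  series-cong : ∀ {W W′ : Weight l} → (∀ v → W v ≡ W′ v) → ∀ n → series l W n ≡ series l W′ n
  series-cong e n = at (S-cong l n e) n ℕₚ.≤-refl
    where open Truncated n

  series-⊕ : ∀ (W W′ : Weight l) n → series l (λ v → W v ✚ W′ v) n ≡ (series l W ⊕ series l W′) n
  series-⊕ W W′ n = at (S-⊕ l W W′ n) n ℕₚ.≤-refl
    where open Truncated n

  series-· : ∀ c (W : Weight l) n → series l (λ v → c ✖ W v) n ≡ (c · series l W) n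
  series-· c W n = at (S-· l c W n) n ℕₚ.≤-refl
    where open Truncated n

dq-series : ∀ l W n → dq (series l W) n ≡
  (series (suc l) (insertU l W) ⊕ series l (splitV l W) ⊕ series l (partialSums l 0 W) ⊕ -1ℚ · series (suc l) (insertV l 0 W)) n
dq-series l W n = begin
  -- The `insertV` term stands beside the derivative in `dq-S`; adding and subtracting it isolates
  -- the derivative.
  dq (series l W) n                           ≡⟨ solve 2 (λ x y → x := x :+ y :+ con -1ℚ :* y) refl (dq (series l W) n) y ⟩
  dq (series l W) n ✚ y ✚ -1ℚ ✖ y             ≡⟨ cong (_✚ -1ℚ ✖ y) (at (dq-S l W) n ℕₚ.≤-refl) ⟩
  _                                           ∎
  where
    open Truncated n
    open ≡-Reasoning
    open +-*-Solver
    y = series (suc l) (insertV l 0 W) n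

-- Spans of brackets

-- Unfolds to `InMD` for Q = `Admissible` and to `InFil k l` for Q = `Fil k l`, so both halves of
-- the theorem share their lemmas.
InSpan : (List ℕ → Set) → Series → Set
InSpan Q f = Σ LinComb λ L → All (λ p → Q (proj₂ p)) L × (∀ n → f n ≡ evalLC L n)

evalLC-++ : ∀ L L′ n → evalLC (L ++ L′) n ≡ evalLC L n ✚ evalLC L′ n
evalLC-++ []            L′ n = sym (ℚₚ.+-identityˡ (evalLC L′ n))
evalLC-++ ((c , s) ∷ L) L′ n = trans (cong (c ✖ bracket s n ✚_) (evalLC-++ L L′ n))
  (sym (ℚₚ.+-assoc (c ✖ bracket s n) (evalLC L n) (evalLC L′ n)))

scaleLC : ℚ → LinComb → LinComb
scaleLC c = List.map (λ (d , s) → c ✖ d , s)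

evalLC-scale : ∀ c L n → evalLC (scaleLC c L) n ≡ c ✖ evalLC L n
evalLC-scale c []            n = sym (ℚₚ.*-zeroʳ c)
evalLC-scale c ((d , s) ∷ L) n = trans
  (cong₂ _✚_ (ℚₚ.*-assoc c d (bracket s n)) (evalLC-scale c L n))
  (sym (ℚₚ.*-distribˡ-+ c (d ✖ bracket s n) (evalLC L n)))

module _ {Q : List ℕ → Set} where

  span-ext : ∀ {f g} → (∀ n → g n ≡ f n) → InSpan Q f → InSpan Q g
  span-ext e (L , q , p) = L , q , λ n → trans (e n) (p n)

  span-0 : InSpan Q (λ _ → 0ℚ)
  span-0 = [] , [] , λ _ → refl

  span-⊕ : ∀ {f g} → InSpan Q f → InSpan Q g → InSpan Q (f ⊕ g)
  span-⊕ (L , q , p) (L′ , q′ , p′) = L ++ L′ , Allₚ.++⁺ q q′ , λ n → trans (cong₂ _✚_ (p n) (p′ n)) (sym (evalLC-++ L L′ n))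

  span-· : ∀ {f} c → InSpan Q f → InSpan Q (c · f)
  span-· c (L , q , p) = scaleLC c L , Allₚ.map⁺ q , λ n → trans (cong (c ✖_) (p n)) (sym (evalLC-scale c L n))

  span-bracket : ∀ ss → Q ss → InSpan Q (bracket ss)
  span-bracket ss q = (1ℚ , ss) ∷ [] , q ∷ [] , λ n → sym (trans (ℚₚ.+-identityʳ (1ℚ ✖ bracket ss n)) (ℚₚ.*-identityˡ (bracket ss n)))

span-dq : ∀ {Q Q′ : List ℕ → Set} → (∀ ss → Q ss → InSpan Q′ (dq (bracket ss))) → ∀ {f} → InSpan Q f → InSpan Q′ (dq f)
span-dq {Q} {Q′} h (L , q , p) = span-ext (λ n → cong (val n ✖_) (p n)) (go L q)
  where
    open +-*-Solver
    go : ∀ L → All (λ p → Q (proj₂ p)) L → InSpan Q′ (dq (evalLC L))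
    go []            []       = span-ext (λ n → ℚₚ.*-zeroʳ (val n)) span-0
    go ((c , s) ∷ L) (q ∷ qs) = span-ext
      (λ n → solve 4 (λ x c b e → x :* (c :* b :+ e) := c :* (x :* b) :+ x :* e) refl (val n) c (bracket s n) (evalLC L n))
      (span-⊕ (span-· c (h s q)) (go L qs))

Fil : ℕ → ℕ → List ℕ → Set
Fil k l ss = Admissible ss × weight ss ≤ k × List.length ss ≤ l

sucs : ∀ {l} → Vec ℕ l → List ℕ
sucs rs = List.map suc (Vec.toList rs)

minus1-map-suc : ∀ rs → minus1 (List.map suc rs) ≡ rs
minus1-map-suc []       = refl
minus1-map-suc (r ∷ rs) = cong (r ∷_) (minus1-map-suc rs)

weight-sucs : ∀ {l} (rs : Vec ℕ l) → weight (sucs rs) ≡ Vec.sum rs + l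
weight-sucs []               = refl
weight-sucs {suc l} (r ∷ rs) = trans (cong (suc r +_) (weight-sucs rs)) (eq r (Vec.sum rs) l)
  where
    eq : ∀ r s l → suc r + (s + l) ≡ r + s + suc l
    eq = solve-∀

length-sucs : ∀ {l} (rs : Vec ℕ l) → List.length (sucs rs) ≡ l
length-sucs []       = refl
length-sucs (r ∷ rs) = cong suc (length-sucs rs)

admissible-sucs : ∀ {l} (rs : Vec ℕ l) → Admissible (sucs rs)
admissible-sucs []       = []
admissible-sucs (r ∷ rs) = s≤s z≤n ∷ admissible-sucs rs

sucs-Fil : ∀ {l k m} (rs : Vec ℕ l) → Vec.sum rs + l ≤ k → l ≤ m → Fil k m (sucs rs)
sucs-Fil rs w h = admissible-sucs rs
  , ℕₚ.≤-trans (ℕₚ.≤-reflexive (weight-sucs rs)) w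
  , ℕₚ.≤-trans (ℕₚ.≤-reflexive (length-sucs rs)) h

bracket-series : ∀ {l} (rs : Vec ℕ l) n →
  bracket (sucs rs) n ≡ (recip (factProd (sucs rs)) {{factProd≢0 (sucs rs)}} · series l (mono rs)) n
bracket-series rs n = trans (/-val (σ (minus1 (sucs rs)) n) (factProd (sucs rs)) {{factProd≢0 (sucs rs)}})
  (cong (recip (factProd (sucs rs)) {{factProd≢0 (sucs rs)}} ✖_) (trans (cong (λ ss → val (σ ss n)) (minus1-map-suc (Vec.toList rs)))
    (sym (Truncated.S-mono n rs n n ℕₚ.≤-refl))))

span-mono : ∀ {Q l} (rs : Vec ℕ l) → Q (sucs rs) → InSpan Q (series l (mono rs))
span-mono {l = l} rs q = span-ext (λ n → sym (begin
    val F ✖ bracket (sucs rs) n                     ≡⟨ cong (val F ✖_) (bracket-series rs n) ⟩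
    val F ✖ (i ✖ series l (mono rs) n)
      ≡⟨ solve 3 (λ f i s → f :* (i :* s) := i :* f :* s) refl (val F) i (series l (mono rs) n) ⟩
    i ✖ val F ✖ series l (mono rs) n                ≡⟨ cong (_✖ series l (mono rs) n) (1/-val F {{factProd≢0 (sucs rs)}}) ⟩
    1ℚ ✖ series l (mono rs) n                       ≡⟨ ℚₚ.*-identityˡ (series l (mono rs) n) ⟩
    series l (mono rs) n                            ∎))
  (span-· (val F) (span-bracket (sucs rs) q))
  where
    open ≡-Reasoning
    open +-*-Solver
    F = factProd (sucs rs)
    i = recip F {{factProd≢0 (sucs rs)}}

-- From polynomial weights to brackets.

bump : ∀ {l} → Vec ℕ l → Fin l → Vec ℕ l
bump rs i = Vec.updateAt rs i suc

mono-bump : ∀ {l} (rs : Vec ℕ l) i v → mono (bump rs i) v ≡ val (lookup v i) ✖ mono rs v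
mono-bump (r ∷ rs) zero    (v ∷ vs) = trans (cong (_✖ mono rs vs) (val-* v (v ^ r))) (ℚₚ.*-assoc (val v) (val (v ^ r)) (mono rs vs))
mono-bump (r ∷ rs) (suc i) (v ∷ vs) = trans (cong (val (v ^ r) ✖_) (mono-bump rs i vs))
  (solve 3 (λ a b c → a :* (b :* c) := b :* (a :* c)) refl (val (v ^ r)) (val (lookup vs i)) (mono rs vs))
  where open +-*-Solver

sum-bump : ∀ {l} (rs : Vec ℕ l) i → Vec.sum (bump rs i) ≡ suc (Vec.sum rs)
sum-bump (r ∷ rs) zero    = refl
sum-bump (r ∷ rs) (suc i) = trans (cong (r +_) (sum-bump rs i)) (ℕₚ.+-suc r (Vec.sum rs))

-- The monomial `rs` is an accumulator: each variable factor of the polynomial moves into its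
-- exponents, which keeps `Vec.sum rs + d` fixed, until a constant times a monomial is left.
span-poly-mono : ∀ {l d f k m} → Poly l d f → (rs : Vec ℕ l) → Vec.sum rs + d + l ≤ k → l ≤ m →
  InSpan (Fil k m) (series l (λ v → f v ✖ mono rs v))
span-poly-mono {l} {d} (const c) rs w h = span-ext (series-· c (mono rs))
  (span-· c (span-mono rs (sucs-Fil rs (ℕₚ.≤-trans (ℕₚ.+-monoˡ-≤ l (ℕₚ.m≤m+n (Vec.sum rs) d)) w) h)))
span-poly-mono {l} (var {d} {f} i p) rs w h = span-ext
  (series-cong λ v → trans (solve 3 (λ x y z → x :* y :* z := y :* (x :* z)) refl (val (lookup v i)) (f v) (mono rs v))
    (cong (f v ✖_) (sym (mono-bump rs i v))))
  (span-poly-mono p (bump rs i) (ℕₚ.≤-trans (ℕₚ.≤-reflexive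
    (cong (_+ l) (trans (cong (_+ d) (sum-bump rs i)) (sym (ℕₚ.+-suc (Vec.sum rs) d))))) w) h)
  where open +-*-Solver
span-poly-mono (Poly.add {f = f} {g} p q) rs w h = span-ext
  (λ n → trans (series-cong (λ v → ℚₚ.*-distribʳ-+ (mono rs v) (f v) (g v)) n) (series-⊕ (λ v → f v ✖ mono rs v) (λ v → g v ✖ mono rs v) n))
  (span-⊕ (span-poly-mono p rs w h) (span-poly-mono q rs w h))
span-poly-mono (Poly.ext e p) rs w h = span-ext (series-cong λ v → cong (_✖ mono rs v) (sym (e v))) (span-poly-mono p rs w h)

span-poly : ∀ {l d f k m} → Poly l d f → d + l ≤ k → l ≤ m → InSpan (Fil k m) (series l f)
span-poly {l} {d} {f} p w h = span-ext
  (series-cong λ v → sym (trans (cong (f v ✖_) (mono-0 v)) (ℚₚ.*-identityʳ (f v))))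
  (span-poly-mono p (Vec.replicate l 0) (ℕₚ.≤-trans (ℕₚ.≤-reflexive (cong (λ s → s + d + l) (sum-0s l))) w) h)
  where
    mono-0 : ∀ {l} (v : Vec ℕ l) → mono (Vec.replicate l 0) v ≡ 1ℚ
    mono-0 []       = refl
    mono-0 (x ∷ v) = trans (ℚₚ.*-identityˡ (mono (Vec.replicate _ 0) v)) (mono-0 v)

    sum-0s : ∀ l → Vec.sum (Vec.replicate l 0) ≡ 0
    sum-0s zero    = refl
    sum-0s (suc l) = sum-0s l

-- Takes the coordinate functions themselves as environment, at which `evalAt` is the identity.
family-poly : ∀ {l k} (W : Weight l) → PolyFamily k (λ _ → W) → Poly l k W
family-poly W p = Poly.ext (λ v → cong W (trans (sym (Vecₚ.tabulate-∘ _ _)) (Vecₚ.tabulate∘lookup v)))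
  (p (Vec.tabulate (flip lookup)) (VecAllₚ.tabulate⁺ λ i → affine (Poly.ext (λ v → ℚₚ.*-identityʳ (val (lookup v i))) (var i (const 1ℚ)))))

-- The derivative of a bracket.

affine-0 : ∀ {l} → Affine {l} (λ _ → 0)
affine-0 = affine (const 0ℚ)

-- A weight of degree D in length L gives brackets of weight at most D + L. With s the sum of `rs`,
-- the terms of length l + 1 have degree s + 1 and that of `splitV` has degree s + 2 in length l, so
-- all stay within s + l + 2; `partialSums` stays one below.
span-dq-mono : ∀ {l k m} (rs : Vec ℕ l) → Vec.sum rs + l ≤ k → l ≤ m →
  InSpan (Fil (k + 2) (m + 1)) (dq (series l (mono rs)))
span-dq-mono {l} {k} {m} rs w h = span-ext (dq-series l (mono rs))
  (span-⊕ (span-⊕ (span-⊕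
    (span-poly (family-poly (insertU l (mono rs)) (insertU-poly l (λ _ → mono rs) (mono-poly rs))) long (s≤m+1 h))
    (span-poly (family-poly (splitV l (mono rs)) (splitV-poly rs)) short (ℕₚ.m≤n⇒m≤n+o 1 h)))
    (span-poly (family-poly (partialSums l 0 (mono rs)) (partialSums-poly l (λ _ → mono rs) affine-0 (mono-poly rs)))
      (ℕₚ.≤-trans (ℕₚ.n≤1+n _) short) (ℕₚ.m≤n⇒m≤n+o 1 h)))
    (span-· -1ℚ (span-poly (family-poly (insertV l 0 (mono rs)) (insertV-poly l (λ _ → mono rs) affine-0 (mono-poly rs))) long (s≤m+1 h))))
  where
    short : 2 + Vec.sum rs + l ≤ k + 2
    short = ℕₚ.≤-trans (s≤s (s≤s w)) (ℕₚ.≤-reflexive (ℕₚ.+-comm 2 k))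

    long : suc (Vec.sum rs) + suc l ≤ k + 2
    long = ℕₚ.≤-trans (ℕₚ.≤-reflexive (cong suc (ℕₚ.+-suc (Vec.sum rs) l))) short

    s≤m+1 : l ≤ m → suc l ≤ m + 1
    s≤m+1 h = ℕₚ.≤-trans (s≤s h) (ℕₚ.≤-reflexive (ℕₚ.+-comm 1 m))

sucs-minus1 : ∀ {ss} → Admissible ss → sucs (Vec.fromList (minus1 ss)) ≡ ss
sucs-minus1 []                           = refl
sucs-minus1 {suc s ∷ ss} (s≤s _ ∷ as) = cong (suc s ∷_) (sucs-minus1 as)

span-dq-bracket : ∀ {k l} ss → Fil k l ss → InSpan (Fil (k + 2) (l + 1)) (dq (bracket ss))
span-dq-bracket {k} {l} ss (a , w , h) = subst (λ t → InSpan (Fil (k + 2) (l + 1)) (dq (bracket t))) eq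
  (span-ext (λ n → trans (cong (val n ✖_) (bracket-series rs n))
      (solve 3 (λ x i s → x :* (i :* s) := i :* (x :* s)) refl (val n) i (series _ (mono rs) n)))
    (span-· i (span-dq-mono rs
      (ℕₚ.≤-trans (ℕₚ.≤-reflexive (trans (sym (weight-sucs rs)) (cong weight eq))) w)
      (ℕₚ.≤-trans (ℕₚ.≤-reflexive (trans (sym (length-sucs rs)) (cong List.length eq))) h))))
  where
    open +-*-Solver
    rs = Vec.fromList (minus1 ss)
    eq : sucs rs ≡ ss
    eq = sucs-minus1 a
    i = recip (factProd (sucs rs)) {{factProd≢0 (sucs rs)}}

mainTheorem2 : ((f : Series) → InMD f → InMD (dq f))
    × ((k l : ℕ) (f : Series) → InFil k l f → InFil (k + 2) (l + 1) (dq f))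
-- For the first half, each bracket is placed in the filtration step of its own weight and length,
-- and the bounds on the result are then forgotten.
mainTheorem2 = (λ f → span-dq λ ss a → forget (span-dq-bracket ss (a , ℕₚ.≤-refl , ℕₚ.≤-refl)))
  , λ k l f → span-dq span-dq-bracket
  where
    forget : ∀ {k l f} → InSpan (Fil k l) f → InSpan Admissible f
    forget (L , q , p) = L , All.map proj₁ q , p
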